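{- For every prime power $q$ and every integer $v>1$, $$\mathcal{G}_v(q)=(q+1)\sum_{0\le u<v}N_{v,u}(q).$$
   Context: Let $q$ be a prime power, $\mathbb{F}_q$ the field with $q$ elements and $\mathcal{P}^1(\mathbb{F}_q)=\mathbb{F}_q\cup\{\infty\}$. Let $V,U$ be nonzero polynomials over $\mathbb{F}_q$ with $\gcd(V,U)=1$, of degrees $v,u$ and leading coefficients $a_v,b_u$. The rational function $V(x)/U(x)$ is evaluated on $\mathcal{P}^1(\mathbb{F}_q)$ as follows: at $a\in\mathbb{F}_q$ its value is $V(a)/U(a)$, understood as $\infty$ if $U(a)=0$; at $\infty$ its value is $\infty$ if $v>u$, $0$ if $v<u$, and $a_v/b_v$ if $v=u$. It is a permutation rational function (PRF) if it permutes $\mathcal{P}^1(\mathbb{F}_q)$. $P_{v,u}(q)$ is the set of PRFs $V(x)/U(x)$ (as rational functions, so $V/U$ and $(cV)/(cU)$ with $c\in\mathbb{F}_q\setminus\{0\}$ are the same element) with $\deg V=v$ and $\deg U=u$, and $N_{v,u}(q)=|P_{v,u}(q)|$. The number of PRFs of degree $v$ is $\mathcal{G}_v(q)=N_{v,v}(q)+2\sum_{0\le u<v}N_{v,u}(q)$. -}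

module Defs where

open import Algebra.Apartness.Bundles using (HeytingField; HeytingCommutativeRing)
import Algebra.Apartness.Properties.HeytingCommutativeRing as HeytingProperties
open import Algebra.Bundles using (CommutativeRing)
import Algebra.Properties.CommutativeSemigroup as CommutativeSemigroupProperties
import Algebra.Properties.Ring as RingProperties
import Algebra.Properties.Semiring.Divisibility as SemiringDivisibility
import Algebra.Properties.Semiring.Primality as SemiringPrimality
open import Data.Empty using (⊥-elim)
open import Data.Fin using (Fin)
import Data.Fin.Properties as Fin
open import Data.List using
  (List; []; _∷_; [_]; map; length; lookup; tabulate; upTo; deduplicate; cartesianProductWith; cartesianProduct)
import Data.List.Membership.Setoid as Membership
import Data.List.Membership.Setoid.Properties as Membershipₚ
open import Data.List.Relation.Unary.All as All using (All)
open import Data.List.Relation.Unary.Any as Any using (Any; here; there; index)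
import Data.List.Relation.Unary.Any.Properties as Anyₚ
open import Data.List.Relation.Unary.AllPairs using (AllPairs; []; _∷_)
open import Data.List.Relation.Unary.Enumerates.Setoid using (IsEnumeration)
import Data.List.Relation.Unary.Enumerates.Setoid.Properties as Enumeratesₚ
open import Data.List.Relation.Unary.Unique.DecSetoid.Properties using (deduplicate-!)
open import Data.Maybe using (Maybe; just; nothing)
import Data.Maybe.Relation.Binary.Pointwise as Pointwise
open import Data.Nat as ℕ using (ℕ; zero; suc; z≤n; s≤s)
open import Data.Nat.ListAction using (sum)
import Data.Nat.Properties as ℕ
open import Data.Nat.Primality using (Prime)
open import Data.Product using (Σ; ∃; ∃₂; _×_; _,_; proj₁; proj₂; uncurry)
open import Data.Sum using (_⊎_; inj₁; inj₂)
open import Function using (_∘_; _on_)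
open import Function.Bundles using (Inverse)
open import Function.Definitions using (Injective; Surjective; Bijective)
open import Level using (Level; _⊔_)
open import Relation.Binary using
  (Setoid; DecSetoid; IsEquivalence; Rel; Decidable; _Respects_; tri<; tri≈; tri>)
open import Relation.Binary.PropositionalEquality as ≡ using (_≡_)
import Relation.Binary.Reasoning.Setoid as SetoidReasoning
open import Relation.Nullary using (¬_; Dec; yes; no; contradiction)
open import Relation.Nullary.Decidable as Dec using (_×-dec_; _→-dec_)
open import Relation.Unary as U using (Pred)

private variable
  a p ℓ : Level

PrimePower : ℕ → Set
PrimePower q = ∃₂ λ p k → Prime p × 1 ℕ.≤ k × q ≡ p ℕ.^ k

HasSize : Setoid a ℓ → ℕ → Set (a ⊔ ℓ)
HasSize S n = Inverse S (≡.setoid (Fin n))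

Finite : Setoid a ℓ → Set (a ⊔ ℓ)
Finite S = ∃ (HasSize S)

lookup-injective : (S : Setoid a ℓ) → let open Setoid S in
  ∀ {xs} → AllPairs (λ x y → ¬ (x ≈ y)) xs → Injective _≡_ _≈_ (lookup xs)
lookup-injective S (_ ∷ _)  {Fin.zero}  {Fin.zero}  _  = ≡.refl
lookup-injective S (x# ∷ _) {Fin.zero}  {Fin.suc j} eq =
  ⊥-elim (All.lookupₛ (≡.setoid _) (λ { ≡.refl z → z }) x# (Membershipₚ.∈-lookup (≡.setoid _) _ j) eq)
lookup-injective S (x# ∷ _) {Fin.suc i} {Fin.zero}  eq =
  ⊥-elim (All.lookupₛ (≡.setoid _) (λ { ≡.refl z → z }) x# (Membershipₚ.∈-lookup (≡.setoid _) _ i) (Setoid.sym S eq))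
lookup-injective S (_ ∷ u)  {Fin.suc i} {Fin.suc j} eq = ≡.cong Fin.suc (lookup-injective S u eq)

enumeration⇒finite : (S : DecSetoid a ℓ) → let open DecSetoid S in
  ∀ {xs} → IsEnumeration setoid xs → Finite setoid
enumeration⇒finite S {xs} enum = length ys , record
  { to        = λ x → index (enum′ x)
  ; from      = lookup ys
  ; to-cong   = λ {x} {y} x≈y → lookup-injective setoid (deduplicate-! S xs)
                  (trans (sym (at x)) (trans x≈y (at y)))
  ; from-cong = λ { ≡.refl → refl }
  ; inverse   = (λ {i} {x} x≈ → lookup-injective setoid (deduplicate-! S xs) (trans (sym (at x)) x≈))
              , (λ { {x} ≡.refl → sym (at x) })
  }
  where
  open DecSetoid S
  ys = deduplicate _≟_ xs
  enum′ : IsEnumeration setoid ys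
  enum′ = Enumeratesₚ.deduplicate⁺ S enum
  at : ∀ x → x ≈ lookup ys (index (enum′ x))
  at x = Anyₚ.lookup-index (enum′ x)

select : {A : Set a} {P : Pred A p} → U.Decidable P → List A → List (Σ A P)
select P? [] = []
select P? (x ∷ xs) with P? x
... | yes px = (x , px) ∷ select P? xs
... | no  _  = select P? xs

select⁺ : {A : Set a} {P : Pred A p} (P? : U.Decidable P) {Q : Pred A ℓ} →
  (∀ {x} → Q x → P x) → ∀ {xs} → Any Q xs → Any (Q ∘ proj₁) (select P? xs)
select⁺ P? Q⇒P {x ∷ xs} (here qx) with P? x
... | yes px = here qx
... | no ¬px = contradiction (Q⇒P qx) ¬px
select⁺ P? Q⇒P {x ∷ xs} (there any) with P? x
... | yes px = there (select⁺ P? Q⇒P any)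
... | no ¬px = select⁺ P? Q⇒P any

module Search (S : Setoid a ℓ) {xs} (enum : IsEnumeration S xs) where
  open Setoid S

  all? : {P : Pred Carrier p} → P Respects _≈_ → U.Decidable P → Dec (∀ x → P x)
  all? resp P? = Dec.map′
    (λ all x → All.lookupₛ S resp all (enum x))
    (λ f → All.universal f xs)
    (All.all? P? xs)

  any? : {P : Pred Carrier p} → P Respects _≈_ → U.Decidable P → Dec (∃ P)
  any? resp P? = Dec.map′ Any.satisfied
    (λ { (x , px) → Any.map (λ x≈y → resp x≈y px) (enum x) })
    (Any.any? P? xs)

module Polynomial {a ℓ} (R : CommutativeRing a ℓ) where

  open CommutativeRing R
  open RingProperties ring using (-0#≈0#)

  -- Coefficients in increasing order of degree; trailing zeros are allowed.
  Poly : Set a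
  Poly = List Carrier

  coeff : Poly → ℕ → Carrier
  coeff []      n       = 0#
  coeff (x ∷ f) zero    = x
  coeff (x ∷ f) (suc n) = coeff f n

  infix 4 _≈ₚ_
  record _≈ₚ_ (f g : Poly) : Set ℓ where
    constructor coeffs
    field at : ∀ n → coeff f n ≈ coeff g n
  open _≈ₚ_ public

  infixl 6 _+ₚ_
  infixl 7 _·ₚ_ _*ₚ_

  _+ₚ_ : Poly → Poly → Poly
  []      +ₚ g       = g
  (x ∷ f) +ₚ []      = x ∷ f
  (x ∷ f) +ₚ (y ∷ g) = x + y ∷ f +ₚ g

  _·ₚ_ : Carrier → Poly → Poly
  c ·ₚ f = map (c *_) f

  -ₚ_ : Poly → Poly
  -ₚ f = map -_ f

  _*ₚ_ : Poly → Poly → Poly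
  []      *ₚ g = []
  (x ∷ f) *ₚ g = x ·ₚ g +ₚ (0# ∷ f *ₚ g)

  _⟨_⟩ : Poly → Carrier → Carrier
  []      ⟨ x ⟩ = 0#
  (c ∷ f) ⟨ x ⟩ = c + x * f ⟨ x ⟩

  record Degree (f : Poly) (n : ℕ) : Set ℓ where
    constructor degree
    field
      leading≉0 : coeff f n ≉ 0#
      above≈0   : ∀ {m} → n ℕ.< m → coeff f m ≈ 0#
  open Degree public

  ≈ₚ-isEquivalence : IsEquivalence _≈ₚ_
  ≈ₚ-isEquivalence = record
    { refl  = coeffs λ n → refl
    ; sym   = λ e → coeffs λ n → sym (at e n)
    ; trans = λ d e → coeffs λ n → trans (at d n) (at e n)
    }

  open IsEquivalence ≈ₚ-isEquivalence public
    using () renaming (refl to ≈ₚ-refl; sym to ≈ₚ-sym; trans to ≈ₚ-trans)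

  ≈ₚ-setoid : Setoid a ℓ
  ≈ₚ-setoid = record { isEquivalence = ≈ₚ-isEquivalence }

  ∷-cong : ∀ {x y f g} → x ≈ y → f ≈ₚ g → x ∷ f ≈ₚ y ∷ g
  ∷-cong x≈y f≈g = coeffs λ { zero → x≈y ; (suc n) → at f≈g n }

  coeff-+ : ∀ f g n → coeff (f +ₚ g) n ≈ coeff f n + coeff g n
  coeff-+ []      g       n       = sym (+-identityˡ _)
  coeff-+ (x ∷ f) []      n       = sym (+-identityʳ _)
  coeff-+ (x ∷ f) (y ∷ g) zero    = refl
  coeff-+ (x ∷ f) (y ∷ g) (suc n) = coeff-+ f g n

  coeff-· : ∀ c f n → coeff (c ·ₚ f) n ≈ c * coeff f n
  coeff-· c []      n       = sym (zeroʳ c)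
  coeff-· c (x ∷ f) zero    = refl
  coeff-· c (x ∷ f) (suc n) = coeff-· c f n

  coeff-neg : ∀ f n → coeff (-ₚ f) n ≈ - coeff f n
  coeff-neg []      n       = sym -0#≈0#
  coeff-neg (x ∷ f) zero    = refl
  coeff-neg (x ∷ f) (suc n) = coeff-neg f n

  +ₚ-cong : ∀ {f f′ g g′} → f ≈ₚ f′ → g ≈ₚ g′ → f +ₚ g ≈ₚ f′ +ₚ g′
  +ₚ-cong {f} {f′} {g} {g′} d e = coeffs λ n → begin
    coeff (f +ₚ g) n         ≈⟨ coeff-+ f g n ⟩
    coeff f n + coeff g n    ≈⟨ +-cong (at d n) (at e n) ⟩
    coeff f′ n + coeff g′ n  ≈⟨ coeff-+ f′ g′ n ⟨
    coeff (f′ +ₚ g′) n       ∎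
    where open SetoidReasoning setoid

  ·ₚ-cong : ∀ {c d f g} → c ≈ d → f ≈ₚ g → c ·ₚ f ≈ₚ d ·ₚ g
  ·ₚ-cong {c} {d} {f} {g} c≈d e = coeffs λ n → begin
    coeff (c ·ₚ f) n  ≈⟨ coeff-· c f n ⟩
    c * coeff f n     ≈⟨ *-cong c≈d (at e n) ⟩
    d * coeff g n     ≈⟨ coeff-· d g n ⟨
    coeff (d ·ₚ g) n  ∎
    where open SetoidReasoning setoid

  -ₚ-cong : ∀ {f g} → f ≈ₚ g → -ₚ f ≈ₚ -ₚ g
  -ₚ-cong {f} {g} e = coeffs λ n → begin
    coeff (-ₚ f) n  ≈⟨ coeff-neg f n ⟩
    - coeff f n     ≈⟨ -‿cong (at e n) ⟩
    - coeff g n     ≈⟨ coeff-neg g n ⟨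
    coeff (-ₚ g) n  ∎
    where open SetoidReasoning setoid

  +ₚ-assoc : ∀ f g h → (f +ₚ g) +ₚ h ≈ₚ f +ₚ (g +ₚ h)
  +ₚ-assoc f g h = coeffs λ n → begin
    coeff ((f +ₚ g) +ₚ h) n                ≈⟨ coeff-+ (f +ₚ g) h n ⟩
    coeff (f +ₚ g) n + coeff h n           ≈⟨ +-congʳ (coeff-+ f g n) ⟩
    (coeff f n + coeff g n) + coeff h n    ≈⟨ +-assoc _ _ _ ⟩
    coeff f n + (coeff g n + coeff h n)    ≈⟨ +-congˡ (coeff-+ g h n) ⟨
    coeff f n + coeff (g +ₚ h) n           ≈⟨ coeff-+ f (g +ₚ h) n ⟨
    coeff (f +ₚ (g +ₚ h)) n                ∎
    where open SetoidReasoning setoid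

  +ₚ-comm : ∀ f g → f +ₚ g ≈ₚ g +ₚ f
  +ₚ-comm f g = coeffs λ n → begin
    coeff (f +ₚ g) n       ≈⟨ coeff-+ f g n ⟩
    coeff f n + coeff g n  ≈⟨ +-comm _ _ ⟩
    coeff g n + coeff f n  ≈⟨ coeff-+ g f n ⟨
    coeff (g +ₚ f) n       ∎
    where open SetoidReasoning setoid

  +ₚ-identityʳ : ∀ f → f +ₚ [] ≈ₚ f
  +ₚ-identityʳ f = +ₚ-comm f []

  -ₚ-inverseˡ : ∀ f → (-ₚ f) +ₚ f ≈ₚ []
  -ₚ-inverseˡ f = coeffs λ n → begin
    coeff ((-ₚ f) +ₚ f) n       ≈⟨ coeff-+ (-ₚ f) f n ⟩
    coeff (-ₚ f) n + coeff f n  ≈⟨ +-congʳ (coeff-neg f n) ⟩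
    - coeff f n + coeff f n     ≈⟨ -‿inverseˡ _ ⟩
    0#                          ∎
    where open SetoidReasoning setoid

  ·ₚ-distrib : ∀ c f g → c ·ₚ (f +ₚ g) ≈ₚ c ·ₚ f +ₚ c ·ₚ g
  ·ₚ-distrib c f g = coeffs λ n → begin
    coeff (c ·ₚ (f +ₚ g)) n                ≈⟨ coeff-· c (f +ₚ g) n ⟩
    c * coeff (f +ₚ g) n                   ≈⟨ *-congˡ (coeff-+ f g n) ⟩
    c * (coeff f n + coeff g n)            ≈⟨ distribˡ c _ _ ⟩
    c * coeff f n + c * coeff g n          ≈⟨ +-cong (coeff-· c f n) (coeff-· c g n) ⟨
    coeff (c ·ₚ f) n + coeff (c ·ₚ g) n    ≈⟨ coeff-+ (c ·ₚ f) (c ·ₚ g) n ⟨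
    coeff (c ·ₚ f +ₚ c ·ₚ g) n             ∎
    where open SetoidReasoning setoid

  ·ₚ-assoc : ∀ c d f → (c * d) ·ₚ f ≈ₚ c ·ₚ (d ·ₚ f)
  ·ₚ-assoc c d f = coeffs λ n → begin
    coeff ((c * d) ·ₚ f) n   ≈⟨ coeff-· (c * d) f n ⟩
    (c * d) * coeff f n      ≈⟨ *-assoc c d _ ⟩
    c * (d * coeff f n)      ≈⟨ *-congˡ (coeff-· d f n) ⟨
    c * coeff (d ·ₚ f) n     ≈⟨ coeff-· c (d ·ₚ f) n ⟨
    coeff (c ·ₚ (d ·ₚ f)) n  ∎
    where open SetoidReasoning setoid

  ·ₚ-identity : ∀ f → 1# ·ₚ f ≈ₚ f
  ·ₚ-identity f = coeffs λ n → trans (coeff-· 1# f n) (*-identityˡ _)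

  ·ₚ-zero : ∀ f → 0# ·ₚ f ≈ₚ []
  ·ₚ-zero f = coeffs λ n → trans (coeff-· 0# f n) (zeroˡ _)

  0∷-zero : 0# ∷ [] ≈ₚ []
  0∷-zero = coeffs λ { zero → refl ; (suc n) → refl }

  0∷-distrib : ∀ f g → 0# ∷ f +ₚ g ≈ₚ (0# ∷ f) +ₚ (0# ∷ g)
  0∷-distrib f g = ∷-cong (sym (+-identityˡ 0#)) ≈ₚ-refl

  +ₚ-interchange : ∀ f g h k → (f +ₚ g) +ₚ (h +ₚ k) ≈ₚ (f +ₚ h) +ₚ (g +ₚ k)
  +ₚ-interchange = CommutativeSemigroupProperties.interchange record
    { isCommutativeSemigroup = record
      { isSemigroup = record
        { isMagma = record { isEquivalence = ≈ₚ-isEquivalence ; ∙-cong = +ₚ-cong }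
        ; assoc   = +ₚ-assoc
        }
      ; comm = +ₚ-comm
      }
    }

  *ₚ-zeroʳ : ∀ f → f *ₚ [] ≈ₚ []
  *ₚ-zeroʳ []      = ≈ₚ-refl
  *ₚ-zeroʳ (x ∷ f) = ≈ₚ-trans (∷-cong refl (*ₚ-zeroʳ f)) 0∷-zero

  *ₚ-∷ : ∀ f y g → f *ₚ (y ∷ g) ≈ₚ y ·ₚ f +ₚ (0# ∷ f *ₚ g)
  *ₚ-∷ []      y g = ≈ₚ-sym 0∷-zero
  *ₚ-∷ (x ∷ f) y g = ∷-cong (+-congʳ (*-comm x y)) (begin
    x ·ₚ g +ₚ f *ₚ (y ∷ g)                   ≈⟨ +ₚ-cong ≈ₚ-refl (*ₚ-∷ f y g) ⟩
    x ·ₚ g +ₚ (y ·ₚ f +ₚ (0# ∷ f *ₚ g))      ≈⟨ +ₚ-assoc (x ·ₚ g) (y ·ₚ f) _ ⟨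
    (x ·ₚ g +ₚ y ·ₚ f) +ₚ (0# ∷ f *ₚ g)      ≈⟨ +ₚ-cong (+ₚ-comm (x ·ₚ g) (y ·ₚ f)) ≈ₚ-refl ⟩
    (y ·ₚ f +ₚ x ·ₚ g) +ₚ (0# ∷ f *ₚ g)      ≈⟨ +ₚ-assoc (y ·ₚ f) (x ·ₚ g) _ ⟩
    y ·ₚ f +ₚ (x ·ₚ g +ₚ (0# ∷ f *ₚ g))      ∎)
    where open SetoidReasoning ≈ₚ-setoid

  *ₚ-comm : ∀ f g → f *ₚ g ≈ₚ g *ₚ f
  *ₚ-comm []      g = ≈ₚ-sym (*ₚ-zeroʳ g)
  *ₚ-comm (x ∷ f) g = ≈ₚ-trans
    (+ₚ-cong ≈ₚ-refl (∷-cong refl (*ₚ-comm f g)))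
    (≈ₚ-sym (*ₚ-∷ g x f))

  *ₚ-congˡ : ∀ f {g h} → g ≈ₚ h → f *ₚ g ≈ₚ f *ₚ h
  *ₚ-congˡ []      e = ≈ₚ-refl
  *ₚ-congˡ (x ∷ f) e = +ₚ-cong (·ₚ-cong refl e) (∷-cong refl (*ₚ-congˡ f e))

  *ₚ-cong : ∀ {f f′ g g′} → f ≈ₚ f′ → g ≈ₚ g′ → f *ₚ g ≈ₚ f′ *ₚ g′
  *ₚ-cong {f} {f′} {g} {g′} d e = begin
    f *ₚ g    ≈⟨ *ₚ-congˡ f e ⟩
    f *ₚ g′   ≈⟨ *ₚ-comm f g′ ⟩
    g′ *ₚ f   ≈⟨ *ₚ-congˡ g′ d ⟩
    g′ *ₚ f′  ≈⟨ *ₚ-comm g′ f′ ⟩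
    f′ *ₚ g′  ∎
    where open SetoidReasoning ≈ₚ-setoid

  *ₚ-distribˡ : ∀ f g h → f *ₚ (g +ₚ h) ≈ₚ f *ₚ g +ₚ f *ₚ h
  *ₚ-distribˡ []      g h = ≈ₚ-refl
  *ₚ-distribˡ (x ∷ f) g h = begin
    x ·ₚ (g +ₚ h) +ₚ (0# ∷ f *ₚ (g +ₚ h))
      ≈⟨ +ₚ-cong (·ₚ-distrib x g h) (≈ₚ-trans (∷-cong refl (*ₚ-distribˡ f g h)) (0∷-distrib (f *ₚ g) (f *ₚ h))) ⟩
    (x ·ₚ g +ₚ x ·ₚ h) +ₚ ((0# ∷ f *ₚ g) +ₚ (0# ∷ f *ₚ h))
      ≈⟨ +ₚ-interchange (x ·ₚ g) (x ·ₚ h) _ _ ⟩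
    (x ∷ f) *ₚ g +ₚ (x ∷ f) *ₚ h  ∎
    where open SetoidReasoning ≈ₚ-setoid

  *ₚ-distribʳ : ∀ f g h → (g +ₚ h) *ₚ f ≈ₚ g *ₚ f +ₚ h *ₚ f
  *ₚ-distribʳ f g h = begin
    (g +ₚ h) *ₚ f       ≈⟨ *ₚ-comm (g +ₚ h) f ⟩
    f *ₚ (g +ₚ h)       ≈⟨ *ₚ-distribˡ f g h ⟩
    f *ₚ g +ₚ f *ₚ h    ≈⟨ +ₚ-cong (*ₚ-comm f g) (*ₚ-comm f h) ⟩
    g *ₚ f +ₚ h *ₚ f    ∎
    where open SetoidReasoning ≈ₚ-setoid

  ·ₚ-*ₚ : ∀ c f g → (c ·ₚ f) *ₚ g ≈ₚ c ·ₚ (f *ₚ g)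
  ·ₚ-*ₚ c []      g = ≈ₚ-refl
  ·ₚ-*ₚ c (x ∷ f) g = ≈ₚ-trans
    (+ₚ-cong (·ₚ-assoc c x g) (∷-cong (sym (zeroʳ c)) (·ₚ-*ₚ c f g)))
    (≈ₚ-sym (·ₚ-distrib c (x ·ₚ g) (0# ∷ f *ₚ g)))

  *ₚ-assoc : ∀ f g h → (f *ₚ g) *ₚ h ≈ₚ f *ₚ (g *ₚ h)
  *ₚ-assoc []      g h = ≈ₚ-refl
  *ₚ-assoc (x ∷ f) g h = begin
    (x ·ₚ g +ₚ (0# ∷ f *ₚ g)) *ₚ h
      ≈⟨ *ₚ-distribʳ h (x ·ₚ g) (0# ∷ f *ₚ g) ⟩
    (x ·ₚ g) *ₚ h +ₚ (0# ·ₚ h +ₚ (0# ∷ (f *ₚ g) *ₚ h))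
      ≈⟨ +ₚ-cong (·ₚ-*ₚ x g h) (+ₚ-cong (·ₚ-zero h) (∷-cong refl (*ₚ-assoc f g h))) ⟩
    x ·ₚ (g *ₚ h) +ₚ (0# ∷ f *ₚ (g *ₚ h))  ∎
    where open SetoidReasoning ≈ₚ-setoid

  *ₚ-identityˡ : ∀ f → [ 1# ] *ₚ f ≈ₚ f
  *ₚ-identityˡ f = ≈ₚ-trans (+ₚ-cong (·ₚ-identity f) 0∷-zero) (+ₚ-identityʳ f)

  polynomialRing : CommutativeRing a ℓ
  polynomialRing = record
    { Carrier = Poly ; _≈_ = _≈ₚ_ ; _+_ = _+ₚ_ ; _*_ = _*ₚ_ ; -_ = -ₚ_ ; 0# = [] ; 1# = [ 1# ]
    ; isCommutativeRing = record
      { isRing = record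
        { +-isAbelianGroup = record
          { isGroup = record
            { isMonoid = record
              { isSemigroup = record
                { isMagma = record { isEquivalence = ≈ₚ-isEquivalence ; ∙-cong = +ₚ-cong }
                ; assoc   = +ₚ-assoc
                }
              ; identity = (λ f → ≈ₚ-refl) , +ₚ-identityʳ
              }
            ; inverse = -ₚ-inverseˡ , λ f → ≈ₚ-trans (+ₚ-comm f (-ₚ f)) (-ₚ-inverseˡ f)
            ; ⁻¹-cong = -ₚ-cong
            }
          ; comm = +ₚ-comm
          }
        ; *-cong     = *ₚ-cong
        ; *-assoc    = *ₚ-assoc
        ; *-identity = *ₚ-identityˡ , λ f → ≈ₚ-trans (*ₚ-comm f [ 1# ]) (*ₚ-identityˡ f)
        ; distrib    = *ₚ-distribˡ , *ₚ-distribʳ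
        }
      ; *-comm = *ₚ-comm
      }
    }

  open SemiringPrimality (CommutativeRing.semiring polynomialRing) public
    using (Coprime)

  ⟨⟩-zero : ∀ {f} x → f ≈ₚ [] → f ⟨ x ⟩ ≈ 0#
  ⟨⟩-zero {[]}    x e = refl
  ⟨⟩-zero {c ∷ f} x e = begin
    c + x * f ⟨ x ⟩  ≈⟨ +-cong (at e 0) (*-congˡ (⟨⟩-zero {f} x (coeffs (at e ∘ suc)))) ⟩
    0# + x * 0#      ≈⟨ +-identityˡ _ ⟩
    x * 0#           ≈⟨ zeroʳ x ⟩
    0#               ∎
    where open SetoidReasoning setoid

  ⟨⟩-cong : ∀ {f g x y} → f ≈ₚ g → x ≈ y → f ⟨ x ⟩ ≈ g ⟨ y ⟩
  ⟨⟩-cong {[]}    {g}     {y = y} e x≈y = sym (⟨⟩-zero y (≈ₚ-sym e))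
  ⟨⟩-cong {c ∷ f} {[]}    {x = x} e x≈y = ⟨⟩-zero x e
  ⟨⟩-cong {c ∷ f} {d ∷ g}         e x≈y =
    +-cong (at e 0) (*-cong x≈y (⟨⟩-cong {f} {g} (coeffs (at e ∘ suc)) x≈y))

  Degree-resp : ∀ {f g n} → f ≈ₚ g → Degree f n → Degree g n
  Degree-resp e (degree l z) =
    degree (λ g≈0 → l (trans (at e _) g≈0)) (λ n<m → trans (sym (at e _)) (z n<m))

  Degree-unique : ∀ {f m n} → Degree f m → Degree f n → m ≡ n
  Degree-unique {m = m} {n} (degree l z) (degree l′ z′) with ℕ.<-cmp m n
  ... | tri< m<n _ _ = contradiction (z m<n) l′
  ... | tri≈ _ m≡n _ = m≡n
  ... | tri> _ _ n<m = contradiction (z′ n<m) l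

-- Over a carrier of finite size, the apartness of a Heyting field is decidable
-- and coincides with _≉_ (see inverse below), so F is just a field with q
-- elements.
module RationalFunctions
  {a ℓ₁ ℓ₂} (F : HeytingField a ℓ₁ ℓ₂) {q : ℕ}
  (size : HasSize (HeytingField.setoid F) q)
  where

  open HeytingField F using (heytingCommutativeRing; _#_; tight; #⇒invertible)

  commutativeRing : CommutativeRing a ℓ₁
  commutativeRing = HeytingCommutativeRing.commutativeRing heytingCommutativeRing

  open CommutativeRing commutativeRing
  open HeytingProperties heytingCommutativeRing using (x-0≈x; 1#0)
  open Polynomial commutativeRing public
  open RingProperties (CommutativeRing.ring polynomialRing)
    using ([y-z]x≈yx-zx; x∙y⁻¹≈ε⇒x≈y; x≈y⇒x∙y⁻¹≈ε)
  open SemiringDivisibility (CommutativeRing.semiring polynomialRing)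
    using (_∣_; _,_; ∣ʳ-respˡ-≈; ∣ʳ-respʳ-≈)

  elements : List Carrier
  elements = tabulate (Inverse.from size)

  elements-enum : IsEnumeration setoid elements
  elements-enum x = Membershipₚ.∈-resp-≈ setoid (Inverse.inverseʳ size ≡.refl)
    (Membershipₚ.∈-tabulate⁺ setoid (Inverse.to size x))

  module Scalars = Search setoid elements-enum

  infix 4 _≟_
  _≟_ : Decidable _≈_
  x ≟ y = Dec.map′
    (λ eq → trans (sym (Inverse.inverseʳ size ≡.refl)) (Inverse.inverseʳ size eq))
    (Inverse.to-cong size)
    (Inverse.to size x Fin.≟ Inverse.to size y)

  #0⇒invertible : ∀ {x} → x # 0# → ∃ λ y → y * x ≈ 1#
  #0⇒invertible x#0 with #⇒invertible x#0
  ... | y , y*x≈1 , _ =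
    y , trans (*-congˡ (sym (x-0≈x _))) y*x≈1

  inverse : ∀ {x} → x ≉ 0# → ∃ λ y → y * x ≈ 1#
  inverse {x} x≉0 with Scalars.any? (λ y≈z e → trans (*-congʳ (sym y≈z)) e) (λ y → y * x ≟ 1#)
  ... | yes found = found
  ... | no  none  =
    contradiction (proj₁ (tight x 0#) (λ x#0 → none (#0⇒invertible x#0))) x≉0

  1≉0 : 1# ≉ 0#
  1≉0 1≈0 = proj₂ (tight 1# 0#) 1≈0 1#0

  *-cancelˡ-≉0 : ∀ {x y} → x ≉ 0# → x * y ≈ 0# → y ≈ 0#
  *-cancelˡ-≉0 {x} {y} x≉0 xy≈0 with inverse x≉0
  ... | z , zx≈1 = begin
    y            ≈⟨ *-identityˡ y ⟨
    1# * y       ≈⟨ *-congʳ zx≈1 ⟨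
    z * x * y    ≈⟨ *-assoc z x y ⟩
    z * (x * y)  ≈⟨ *-congˡ xy≈0 ⟩
    z * 0#       ≈⟨ zeroʳ z ⟩
    0#           ∎
    where open SetoidReasoning setoid

  P¹ : Set a
  P¹ = Maybe Carrier

  pattern ∞ = nothing

  P¹-setoid : Setoid a (a ⊔ ℓ₁)
  P¹-setoid = Pointwise.setoid setoid

  open Setoid P¹-setoid public using () renaming (_≈_ to _≈¹_)

  -- Division by 0 gives ∞ whatever the numerator; 0 ÷ 0 never arises for
  -- coprime numerator and denominator.
  infixl 7 _÷_
  _÷_ : Carrier → Carrier → P¹
  x ÷ y with y ≟ 0#
  ... | yes _  = ∞
  ... | no y≉0 = just (x * proj₁ (inverse y≉0))

  -- v and u are meant to be the degrees of V and U, so that at ∞, when v ≡ u,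
  -- the coefficients being divided are the leading ones.
  evaluate : (v u : ℕ) (V U : Poly) → P¹ → P¹
  evaluate v u V U (just x) = V ⟨ x ⟩ ÷ U ⟨ x ⟩
  evaluate v u V U ∞ with ℕ.<-cmp v u
  ... | tri< v<u _ _ = just 0#
  ... | tri≈ _ v≡u _ = coeff V v ÷ coeff U u
  ... | tri> _ _ v>u = ∞

  record IsPRF (v u : ℕ) (V U : Poly) : Set (a ⊔ ℓ₁) where
    field
      degree-V : Degree V v
      degree-U : Degree U u
      coprime  : Coprime V U
      permutes : Bijective _≈¹_ _≈¹_ (evaluate v u V U)

  -- Equality of V / U and V′ / U′ in the field of fractions.
  infix 4 _≃_
  _≃_ : Rel (Poly × Poly) ℓ₁
  (V , U) ≃ (V′ , U′) = V *ₚ U′ ≈ₚ V′ *ₚ U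

  ∷-degree : ∀ {c f n} → Degree f n → Degree (c ∷ f) (suc n)
  ∷-degree (degree l z) = degree l λ { (s≤s n<m) → z n<m }

  zero⊎degree : ∀ f → f ≈ₚ [] ⊎ ∃ (Degree f)
  zero⊎degree [] = inj₁ ≈ₚ-refl
  zero⊎degree (c ∷ f) with zero⊎degree f | c ≟ 0#
  ... | inj₂ (n , d) | _       = inj₂ (suc n , ∷-degree d)
  ... | inj₁ f≈0     | yes c≈0 = inj₁ (≈ₚ-trans (∷-cong c≈0 f≈0) 0∷-zero)
  ... | inj₁ f≈0     | no  c≉0 = inj₂ (0 , degree c≉0 λ { (s≤s {n = m} _) → at f≈0 m })

  degree⇒≉0 : ∀ {f n} → Degree f n → ¬ f ≈ₚ []
  degree⇒≉0 d f≈0 = leading≉0 d (at f≈0 _)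

  degree? : ∀ f n → Dec (Degree f n)
  degree? f n with zero⊎degree f
  ... | inj₁ f≈0     = no λ d → degree⇒≉0 d f≈0
  ... | inj₂ (m , d) = Dec.map′ (λ { ≡.refl → d }) (Degree-unique d) (m ℕ.≟ n)

  ≈0? : ∀ f → Dec (f ≈ₚ [])
  ≈0? f with zero⊎degree f
  ... | inj₁ f≈0     = yes f≈0
  ... | inj₂ (_ , d) = no (degree⇒≉0 d)

  infix 4 _≟ₚ_
  _≟ₚ_ : Decidable _≈ₚ_
  f ≟ₚ g = Dec.map′ (x∙y⁻¹≈ε⇒x≈y f g) x≈y⇒x∙y⁻¹≈ε (≈0? (f +ₚ (-ₚ g)))

  *ₚ-degree : ∀ {f g m n} → Degree f m → Degree g n → Degree (f *ₚ g) (m ℕ.+ n)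
  *ₚ-degree {[]} d e = contradiction refl (leading≉0 d)
  *ₚ-degree {c ∷ f} {g} {zero} {n} d e = Degree-resp (≈ₚ-sym c∷f*g≈c·g) (degree
    (λ cg≈0 → leading≉0 e (*-cancelˡ-≉0 (leading≉0 d) (trans (sym (coeff-· c g n)) cg≈0)))
    (λ {m} n<m → trans (coeff-· c g m) (trans (*-congˡ (above≈0 e n<m)) (zeroʳ c))))
    where
    f≈0 : f ≈ₚ []
    f≈0 = coeffs λ n → above≈0 d (s≤s z≤n)
    c∷f*g≈c·g : (c ∷ f) *ₚ g ≈ₚ c ·ₚ g
    c∷f*g≈c·g = ≈ₚ-trans
      (+ₚ-cong ≈ₚ-refl (≈ₚ-trans (∷-cong refl (*ₚ-cong {g = g} f≈0 ≈ₚ-refl)) 0∷-zero))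
      (+ₚ-identityʳ (c ·ₚ g))
  *ₚ-degree {c ∷ f} {g} {suc m} {n} d e = degree
    (λ z → leading≉0 fg (trans (sym (shift ℕ.≤-refl)) z))
    (λ { (s≤s m+n<k) → trans (shift (ℕ.<⇒≤ m+n<k)) (above≈0 fg m+n<k) })
    where
    fg : Degree (f *ₚ g) (m ℕ.+ n)
    fg = *ₚ-degree {f} (degree (leading≉0 d) (λ m<k → above≈0 d (s≤s m<k))) e
    shift : ∀ {k} → m ℕ.+ n ℕ.≤ k → coeff ((c ∷ f) *ₚ g) (suc k) ≈ coeff (f *ₚ g) k
    shift {k} m+n≤k = begin
      coeff (c ·ₚ g +ₚ (0# ∷ f *ₚ g)) (suc k)         ≈⟨ coeff-+ (c ·ₚ g) (0# ∷ f *ₚ g) (suc k) ⟩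
      coeff (c ·ₚ g) (suc k) + coeff (f *ₚ g) k       ≈⟨ +-congʳ (coeff-· c g (suc k)) ⟩
      c * coeff g (suc k) + coeff (f *ₚ g) k          ≈⟨ +-congʳ (*-congˡ (above≈0 e (s≤s (ℕ.≤-trans (ℕ.m≤n+m n m) m+n≤k)))) ⟩
      c * 0# + coeff (f *ₚ g) k                       ≈⟨ +-congʳ (zeroʳ c) ⟩
      0# + coeff (f *ₚ g) k                           ≈⟨ +-identityˡ _ ⟩
      coeff (f *ₚ g) k                                ∎
      where open SetoidReasoning setoid

  *ₚ-cancelʳ : ∀ {f g h n} → Degree h n → f *ₚ h ≈ₚ g *ₚ h → f ≈ₚ g
  *ₚ-cancelʳ {f} {g} {h} dh fh≈gh with zero⊎degree (f +ₚ (-ₚ g))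
  ... | inj₁ f-g≈0   = x∙y⁻¹≈ε⇒x≈y f g f-g≈0
  ... | inj₂ (_ , d) = contradiction [f-g]h≈0 (degree⇒≉0 (*ₚ-degree d dh))
    where
    [f-g]h≈0 : (f +ₚ (-ₚ g)) *ₚ h ≈ₚ []
    [f-g]h≈0 = ≈ₚ-trans ([y-z]x≈yx-zx h f g) (x≈y⇒x∙y⁻¹≈ε fh≈gh)

  polysBelow : ℕ → List Poly
  polysBelow zero    = [ [] ]
  polysBelow (suc n) = cartesianProductWith _∷_ elements (polysBelow n)

  polysBelow-enum : ∀ n {f} → (∀ {m} → n ℕ.≤ m → coeff f m ≈ 0#) → Any (f ≈ₚ_) (polysBelow n)
  polysBelow-enum zero    z = here (coeffs λ n → z z≤n)
  polysBelow-enum (suc n) {f} z =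
    Anyₚ.cartesianProductWith⁺ _∷_ (λ x e → coeffs λ { zero → x ; (suc k) → trans (sym (coeff-tail f k)) (at e k) })
      (elements-enum (coeff f 0)) (polysBelow-enum n {tail f} (λ {m} n≤m → trans (coeff-tail f m) (z (s≤s n≤m))))
    where
    tail : Poly → Poly
    tail []      = []
    tail (c ∷ f) = f
    coeff-tail : ∀ f n → coeff (tail f) n ≈ coeff f (suc n)
    coeff-tail []      n = refl
    coeff-tail (c ∷ f) n = refl

  *ₚ-boundˡ : ∀ {f g h n} → Degree f n → h *ₚ g ≈ₚ f → ∀ {m} → n ℕ.< m → coeff h m ≈ 0#
  *ₚ-boundˡ {f} {g} {h} df hg≈f n<m with zero⊎degree h | zero⊎degree g
  ... | inj₁ h≈0      | _             = at h≈0 _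
  ... | inj₂ _        | inj₁ g≈0      = contradiction
    (≈ₚ-trans (≈ₚ-sym hg≈f) (≈ₚ-trans (*ₚ-congˡ h g≈0) (*ₚ-zeroʳ h))) (degree⇒≉0 df)
  ... | inj₂ (k , dh) | inj₂ (l , dg)
    with ≡.refl ← Degree-unique (Degree-resp hg≈f (*ₚ-degree dh dg)) df =
    above≈0 dh (ℕ.≤-<-trans (ℕ.m≤m+n k l) n<m)

  divides? : ∀ {f n} → Degree f n → ∀ g → Dec (g ∣ f)
  divides? {f} {n} df g = Dec.map′
    (λ any → let h , hg≈f = Any.satisfied any in h , hg≈f)
    (λ { (h , hg≈f) → Any.map (λ h≈h′ → ≈ₚ-trans (*ₚ-cong {f′ = h} {g = g} (≈ₚ-sym h≈h′) ≈ₚ-refl) hg≈f)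
                        (polysBelow-enum (suc n) (*ₚ-boundˡ {g = g} {h} df hg≈f)) })
    (Any.any? (λ h → h *ₚ g ≟ₚ f) (polysBelow (suc n)))

  coprime? : ∀ {V U v u} → Degree V v → Degree U u → Dec (Coprime V U)
  coprime? {V} {U} {v} dV dU = Dec.map′ to from
    (All.all? (λ h → divides? dV h →-dec divides? dU h →-dec divides? degree-1 h) (polysBelow (suc v)))
    where
    degree-1 : Degree [ 1# ] 0
    degree-1 = degree 1≉0 λ { (s≤s _) → refl }
    to : All (λ h → h ∣ V → h ∣ U → h ∣ [ 1# ]) (polysBelow (suc v)) → Coprime V U
    to all {h} h∣V@(k , kh≈V) h∣U = All.lookupWith
      (λ { imp h≈h′ → ∣ʳ-respˡ-≈ (≈ₚ-sym h≈h′)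
             (imp (∣ʳ-respˡ-≈ h≈h′ h∣V) (∣ʳ-respˡ-≈ h≈h′ h∣U)) })
      all (polysBelow-enum (suc v) (*ₚ-boundˡ {g = k} {h} dV (≈ₚ-trans (*ₚ-comm h k) kh≈V)))
    from : Coprime V U → All (λ h → h ∣ V → h ∣ U → h ∣ [ 1# ]) (polysBelow (suc v))
    from c = All.universal (λ h → c {h}) _

  P¹-enum : IsEnumeration P¹-setoid (∞ ∷ map just elements)
  P¹-enum ∞        = here Pointwise.nothing
  P¹-enum (just x) = there (Membershipₚ.∈-map⁺ setoid P¹-setoid Pointwise.just (elements-enum x))

  module Points = Search P¹-setoid P¹-enum
  module ¹ = Setoid P¹-setoid

  infix 4 _≟¹_
  _≟¹_ : Decidable _≈¹_
  _≟¹_ = Pointwise.dec _≟_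

  bijective? : (f : P¹ → P¹) → (∀ {s t} → s ≈¹ t → f s ≈¹ f t) → Dec (Bijective _≈¹_ _≈¹_ f)
  bijective? f f-cong = Dec.map′ (λ i {s} {t} → i s t) (λ i s t → i) injective? ×-dec surjective?
    where
    injective? : Dec (∀ s t → f s ≈¹ f t → s ≈¹ t)
    injective? = Points.all?
      (λ s≈s′ i t e → ¹.trans (¹.sym s≈s′) (i t (¹.trans (f-cong s≈s′) e)))
      (λ s → Points.all?
        (λ t≈t′ i e → ¹.trans (i (¹.trans e (f-cong (¹.sym t≈t′)))) t≈t′)
        (λ t → f s ≟¹ f t →-dec s ≟¹ t))
    surjective? : Dec (Surjective _≈¹_ _≈¹_ f)
    surjective? = Points.all?
      (λ { t≈t′ (s , e) → s , λ r≈s → ¹.trans (e r≈s) t≈t′ })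
      (λ t → Dec.map′
        (λ { (s , e) → s , λ r≈s → ¹.trans (f-cong r≈s) e })
        (λ { (s , e) → s , e ¹.refl })
        (Points.any? (λ s≈s′ e → ¹.trans (f-cong (¹.sym s≈s′)) e) (λ s → f s ≟¹ t)))

  Bijective-resp : {f g : P¹ → P¹} → (∀ s → f s ≈¹ g s) →
    Bijective _≈¹_ _≈¹_ f → Bijective _≈¹_ _≈¹_ g
  Bijective-resp f≗g (inj , surj) =
      (λ {s} {t} e → inj (¹.trans (f≗g s) (¹.trans e (¹.sym (f≗g t)))))
    , (λ t → let s , e = surj t in s , λ {r} r≈s → ¹.trans (¹.sym (f≗g r)) (e r≈s))

  ÷-cong : ∀ {x x′ y y′} → x ≈ x′ → y ≈ y′ → x ÷ y ≈¹ x′ ÷ y′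
  ÷-cong {x} {x′} {y} {y′} x≈x′ y≈y′ with y ≟ 0# | y′ ≟ 0#
  ... | yes _   | yes _    = ¹.refl
  ... | yes y≈0 | no  y′≉0 = contradiction (trans (sym y≈y′) y≈0) y′≉0
  ... | no  y≉0 | yes y′≈0 = contradiction (trans y≈y′ y′≈0) y≉0
  ... | no  y≉0 | no  y′≉0 = Pointwise.just (*-cong x≈x′ (begin
    z             ≈⟨ *-identityʳ z ⟨
    z * 1#        ≈⟨ *-congˡ z′y′≈1 ⟨
    z * (z′ * y′) ≈⟨ *-congˡ (*-congˡ y≈y′) ⟨
    z * (z′ * y)  ≈⟨ *-congˡ (*-comm z′ y) ⟩
    z * (y * z′)  ≈⟨ *-assoc z y z′ ⟨
    (z * y) * z′  ≈⟨ *-congʳ zy≈1 ⟩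
    1# * z′       ≈⟨ *-identityˡ z′ ⟩
    z′            ∎))
    where
    open SetoidReasoning setoid
    z z′ : Carrier
    z      = proj₁ (inverse y≉0)
    z′     = proj₁ (inverse y′≉0)
    zy≈1   = proj₂ (inverse y≉0)
    z′y′≈1 = proj₂ (inverse y′≉0)

  evaluate-cong : ∀ v u {V V′ U U′} → V ≈ₚ V′ → U ≈ₚ U′ → ∀ {s t} → s ≈¹ t →
    evaluate v u V U s ≈¹ evaluate v u V′ U′ t
  evaluate-cong v u V≈V′ U≈U′ (Pointwise.just x≈y) =
    ÷-cong (⟨⟩-cong V≈V′ x≈y) (⟨⟩-cong U≈U′ x≈y)
  evaluate-cong v u V≈V′ U≈U′ Pointwise.nothing with ℕ.<-cmp v u
  ... | tri< _ _ _ = ¹.refl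
  ... | tri≈ _ _ _ = ÷-cong (at V≈V′ v) (at U≈U′ u)
  ... | tri> _ _ _ = ¹.refl

  isPRF? : ∀ v u → U.Decidable (uncurry (IsPRF v u))
  isPRF? v u (V , U) with degree? V v | degree? U u
  ... | no ¬dV | _      = no (¬dV ∘ IsPRF.degree-V)
  ... | yes _  | no ¬dU = no (¬dU ∘ IsPRF.degree-U)
  ... | yes dV | yes dU = Dec.map′
    (λ { (c , b) → record { degree-V = dV ; degree-U = dU ; coprime = λ {z} → c {z} ; permutes = b } })
    (λ r → (λ {z} → IsPRF.coprime r {z}) , IsPRF.permutes r)
    (coprime? dV dU ×-dec bijective? (evaluate v u V U) (evaluate-cong v u ≈ₚ-refl ≈ₚ-refl))

  isPRF-resp : ∀ {v u V V′ U U′} → V ≈ₚ V′ → U ≈ₚ U′ → IsPRF v u V U → IsPRF v u V′ U′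
  isPRF-resp {v} {u} V≈V′ U≈U′ r = record
    { degree-V = Degree-resp V≈V′ degree-V
    ; degree-U = Degree-resp U≈U′ degree-U
    ; coprime  = λ z∣V′ z∣U′ → coprime (∣ʳ-respʳ-≈ (≈ₚ-sym V≈V′) z∣V′) (∣ʳ-respʳ-≈ (≈ₚ-sym U≈U′) z∣U′)
    ; permutes = Bijective-resp (λ s → evaluate-cong v u V≈V′ U≈U′ (¹.refl {s})) permutes
    }
    where open IsPRF r

  ≃-trans : ∀ {V U V′ U′ V″ U″ n} → Degree U′ n →
    (V , U) ≃ (V′ , U′) → (V′ , U′) ≃ (V″ , U″) → (V , U) ≃ (V″ , U″)
  ≃-trans {V} {U} {V′} {U′} {V″} {U″} dU′ VU′≈V′U V′U″≈V″U′ = *ₚ-cancelʳ dU′ (begin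
    V *ₚ U″ *ₚ U′   ≈⟨ xy∙z≈xz∙y V U″ U′ ⟩
    V *ₚ U′ *ₚ U″   ≈⟨ *ₚ-cong VU′≈V′U ≈ₚ-refl ⟩
    V′ *ₚ U *ₚ U″   ≈⟨ xy∙z≈xz∙y V′ U U″ ⟩
    V′ *ₚ U″ *ₚ U   ≈⟨ *ₚ-cong V′U″≈V″U′ ≈ₚ-refl ⟩
    V″ *ₚ U′ *ₚ U   ≈⟨ xy∙z≈xz∙y V″ U′ U ⟩
    V″ *ₚ U *ₚ U′   ∎)
    where
    open SetoidReasoning ≈ₚ-setoid
    open CommutativeSemigroupProperties (CommutativeRing.*-commutativeSemigroup polynomialRing)

  -- P_{v,u}(q). As _≃_ identifies V / U with (cV) / (cU), it counts rational
  -- functions rather than pairs of polynomials.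
  PRF : ℕ → ℕ → DecSetoid (a ⊔ ℓ₁) ℓ₁
  PRF v u = record
    { Carrier          = Σ (Poly × Poly) (uncurry (IsPRF v u))
    ; _≈_              = _≃_ on proj₁
    ; isDecEquivalence = record
      { isEquivalence = record
        { refl  = ≈ₚ-refl
        ; sym   = ≈ₚ-sym
        ; trans = λ { {(V , U) , _} {(V′ , U′) , r} {(V″ , U″) , _} → ≃-trans {V} {U} {V′} {U′} {V″} {U″} (IsPRF.degree-U r) }
        }
      ; _≟_ = λ _ _ → _ ≟ₚ _
      }
    }

  PRF-setoid : ℕ → ℕ → Setoid (a ⊔ ℓ₁) ℓ₁
  PRF-setoid v u = DecSetoid.setoid (PRF v u)

  -- Only the bijection with Fin (N v u) matters, not how it is computed.
  abstract
    PRF-finite : ∀ v u → Finite (PRF-setoid v u)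
    PRF-finite v u = enumeration⇒finite (PRF v u) {select (isPRF? v u)
      (cartesianProduct (polysBelow (suc v)) (polysBelow (suc u)))}
      λ { ((V , U) , r) → Any.map
            (λ { (V≈V′ , U≈U′) → *ₚ-cong V≈V′ (≈ₚ-sym U≈U′) })
            (select⁺ (isPRF? v u) (λ { (V≈V′ , U≈U′) → isPRF-resp V≈V′ U≈U′ r })
              (Anyₚ.cartesianProduct⁺
                (polysBelow-enum (suc v) (above≈0 (IsPRF.degree-V r)))
                (polysBelow-enum (suc u) (above≈0 (IsPRF.degree-U r))))) }

  N : ℕ → ℕ → ℕ
  N v u = proj₁ (PRF-finite v u)

  𝒢 : ℕ → ℕ
  𝒢 v = N v v ℕ.+ 2 ℕ.* sum (map (N v) (upTo v))

{-# OPTIONS --safe #-}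

-- Sending V / U to its value c at ∞ together with the reciprocal of V / U − c
-- is a bijection from P_{v,v} to F* × ⋃_{u<v} P_{v,u}: subtracting c cancels
-- the leading term of V, and translations and t ↦ 1 / t permute P¹. Hence
-- N v v = (q − 1) · Σ_{u<v} N v u.
module Submission where

open import Algebra.Apartness.Bundles using (HeytingField)
open import Algebra.Bundles using (CommutativeRing)
import Algebra.Properties.Group as GroupProperties
import Algebra.Properties.Ring as RingProperties
import Algebra.Properties.Semiring.Divisibility as SemiringDivisibility
open import Data.Fin using (Fin; punchIn; punchOut)
import Data.Fin.Permutation as FinPerm
import Data.Fin.Properties as Fin
open import Data.List using ([]; _∷_; [_]; _∷ʳ_; map; upTo)
import Data.List.Properties as List
open import Data.Maybe as Maybe using (just)
import Data.Maybe.Relation.Binary.Pointwise as Pointwise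
open import Data.Nat as ℕ using (ℕ; zero; suc; s≤s; z≤n)
open import Data.Nat.ListAction using (sum)
import Data.Nat.ListAction.Properties as ListAction
import Data.Nat.Properties as ℕ
open import Data.Product using (Σ; ∃; ∃₂; _×_; _,_; proj₁; proj₂)
open import Data.Product.Function.NonDependent.Setoid using (_×-inverse_)
import Data.Product.Relation.Binary.Pointwise.NonDependent as ×
open × using (_×ₛ_)
open import Data.Sum using (inj₁; inj₂)
open import Data.Sum.Function.Setoid using (_⊎-inverse_)
import Data.Sum.Relation.Binary.Pointwise as ⊎
open ⊎ using (_⊎ₛ_)
open import Function using (_∘_; _on_)
open import Function.Bundles using (Inverse; Bijection)
import Function.Construct.Composition as Compose
import Function.Construct.Symmetry as Symmetry
open import Function.Definitions using (Bijective)
open import Function.Properties.Inverse using (Inverse⇒Bijection)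
open import Level using (Level; _⊔_)
open import Relation.Binary using (Setoid; tri<; tri≈; tri>)
import Relation.Binary.Construct.On as On
open import Relation.Binary.PropositionalEquality as ≡ using (_≡_)
import Relation.Binary.Reasoning.Setoid as SetoidReasoning
open import Relation.Nullary using (¬_; yes; no; contradiction)
open import Defs

private variable
  a b ℓ ℓ′ ℓᵣ : Level

-- Inverses between setoids and sizes of finite setoids.

strict-inverse : (S : Setoid a ℓ) (T : Setoid b ℓ′) →
  let module S = Setoid S; module T = Setoid T in
  (f : S.Carrier → T.Carrier) (g : T.Carrier → S.Carrier) →
  (∀ x y → x S.≈ y → f x T.≈ f y) → (∀ x y → x T.≈ y → g x S.≈ g y) →
  (∀ y → f (g y) T.≈ y) → (∀ x → g (f x) S.≈ x) → Inverse S T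
strict-inverse S T f g f-cong g-cong fg≈id gf≈id = record
  { to        = f
  ; from      = g
  ; to-cong   = f-cong _ _
  ; from-cong = g-cong _ _
  ; inverse   = (λ e → Setoid.trans T (f-cong _ _ e) (fg≈id _))
              , (λ e → Setoid.trans S (g-cong _ _ e) (gf≈id _))
  }

-- A one-to-one correspondence often has a simple description as a relation, while its two maps
-- involve choices of representatives. Here the maps are read off the witnesses of `total` and
-- `surjective`, and every round-trip law follows because the related element is unique up to
-- equality.
inverse-from-relation : (S : Setoid a ℓ) (T : Setoid b ℓ′) →
  let module S = Setoid S; module T = Setoid T in
  (R : S.Carrier → T.Carrier → Set ℓᵣ) →
  (∀ {x x′ y y′} → R x y → R x′ y′ → x S.≈ x′ → y T.≈ y′) →
  (∀ {x x′ y y′} → R x y → R x′ y′ → y T.≈ y′ → x S.≈ x′) →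
  (∀ x → ∃ (R x)) → (∀ y → ∃ λ x → R x y) → Inverse S T
inverse-from-relation S T R functional injective total surjective = record
  { to        = proj₁ ∘ total
  ; from      = proj₁ ∘ surjective
  ; to-cong   = functional (proj₂ (total _)) (proj₂ (total _))
  ; from-cong = injective (proj₂ (surjective _)) (proj₂ (surjective _))
  ; inverse   = functional (proj₂ (total _)) (proj₂ (surjective _))
              , λ e → Setoid.sym S (injective (proj₂ (total _)) (proj₂ (surjective _)) (Setoid.sym T e))
  }

HasSize-unique : {S : Setoid a ℓ} → ∀ {m n} → HasSize S m → HasSize S n → m ≡ n
HasSize-unique sizeₘ sizeₙ = FinPerm.↔⇒≡ (Compose.inverse (Symmetry.inverse sizeₘ) sizeₙ)

HasSize-⊎ : {S : Setoid a ℓ} {T : Setoid b ℓ′} → ∀ {m n} →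
  HasSize S m → HasSize T n → HasSize (S ⊎ₛ T) (m ℕ.+ n)
HasSize-⊎ sizeS sizeT = Compose.inverse (sizeS ⊎-inverse sizeT)
  (Compose.inverse (⊎.Pointwise-≡↔≡ _ _) (Symmetry.inverse Fin.+↔⊎))

HasSize-× : {S : Setoid a ℓ} {T : Setoid b ℓ′} → ∀ {m n} →
  HasSize S m → HasSize T n → HasSize (S ×ₛ T) (m ℕ.* n)
HasSize-× sizeS sizeT = Compose.inverse (sizeS ×-inverse sizeT)
  (Compose.inverse ×.Pointwise-≡↔≡ (Symmetry.inverse Fin.*↔×))

_Without_ : (S : Setoid a ℓ) → Setoid.Carrier S → Setoid (a ⊔ ℓ) ℓ
S Without x = On.setoid {B = Σ (Setoid.Carrier S) λ y → ¬ Setoid._≈_ S y x} S proj₁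

-- `punchIn (to x)` enumerates exactly the indices different from that of x, so relating y to the i
-- with `to y ≡ punchIn (to x) i` closes the gap left by x.
HasSize-Without : (S : Setoid a ℓ) → ∀ {n} → HasSize S (suc n) → ∀ x → HasSize (S Without x) n
HasSize-Without S {n} size x = inverse-from-relation (S Without x) (≡.setoid (Fin n))
  (λ y i → to (proj₁ y) ≡ punchIn (to x) i)
  (λ y↦i y′↦i′ y≈y′ → Fin.punchIn-injective (to x) _ _
    (≡.trans (≡.sym y↦i) (≡.trans (to-cong y≈y′) y′↦i′)))
  (λ { y↦i y′↦i′ ≡.refl → to-injective (≡.trans y↦i (≡.sym y′↦i′)) })
  (λ { (y , y≉x) → punchOut (λ e → y≉x (to-injective (≡.sym e))) , ≡.sym (Fin.punchIn-punchOut _) })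
  (λ i → (from (punchIn (to x) i) , λ e →
      Fin.punchInᵢ≢i (to x) i (≡.trans (≡.sym (strictlyInverseˡ _)) (to-cong e)))
    , strictlyInverseˡ _)
  where
  open Inverse size
  to-injective : ∀ {y z} → to y ≡ to z → Setoid._≈_ S y z
  to-injective = Bijection.injective (Inverse⇒Bijection size)

-- Evaluation, leading coefficients, linear factors and linear combinations of polynomials.

module PolynomialProperties {a ℓ} (R : CommutativeRing a ℓ) where

  open CommutativeRing R
  open Polynomial R
  open RingProperties ring using (-‿distribʳ-*; -‿distribˡ-*)
  open SemiringDivisibility (CommutativeRing.semiring polynomialRing) using (_∣_; _,_)

  ⟨⟩-+ : ∀ f g x → (f +ₚ g) ⟨ x ⟩ ≈ f ⟨ x ⟩ + g ⟨ x ⟩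
  ⟨⟩-+ []      g       x = sym (+-identityˡ _)
  ⟨⟩-+ (c ∷ f) []      x = sym (+-identityʳ _)
  ⟨⟩-+ (c ∷ f) (d ∷ g) x = begin
    (c + d) + x * (f +ₚ g) ⟨ x ⟩             ≈⟨ +-congˡ (*-congˡ (⟨⟩-+ f g x)) ⟩
    (c + d) + x * (f ⟨ x ⟩ + g ⟨ x ⟩)        ≈⟨ +-congˡ (distribˡ x _ _) ⟩
    (c + d) + (x * f ⟨ x ⟩ + x * g ⟨ x ⟩)    ≈⟨ interchange c d _ _ ⟩
    (c + x * f ⟨ x ⟩) + (d + x * g ⟨ x ⟩)    ∎
    where
    open SetoidReasoning setoid
    open import Algebra.Properties.CommutativeSemigroup +-commutativeSemigroup using (interchange)

  ⟨⟩-· : ∀ c f x → (c ·ₚ f) ⟨ x ⟩ ≈ c * f ⟨ x ⟩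
  ⟨⟩-· c []      x = sym (zeroʳ c)
  ⟨⟩-· c (d ∷ f) x = begin
    c * d + x * (c ·ₚ f) ⟨ x ⟩   ≈⟨ +-congˡ (*-congˡ (⟨⟩-· c f x)) ⟩
    c * d + x * (c * f ⟨ x ⟩)    ≈⟨ +-congˡ (x∙yz≈y∙xz x c _) ⟩
    c * d + c * (x * f ⟨ x ⟩)    ≈⟨ distribˡ c d _ ⟨
    c * (d + x * f ⟨ x ⟩)        ∎
    where
    open SetoidReasoning setoid
    open import Algebra.Properties.CommutativeSemigroup *-commutativeSemigroup using (x∙yz≈y∙xz)

  -- Induction along f. If m is zero, the tail of f vanishes and only c times g is left. Otherwise c
  -- times g has no term at position m + n, since g stops at n, and the tail of f supplies the
  -- coefficient.
  coeff-*-top : ∀ {f g m n} → Degree f m → Degree g n →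
    coeff (f *ₚ g) (m ℕ.+ n) ≈ coeff f m * coeff g n
  coeff-*-top {[]}    d e = contradiction refl (leading≉0 d)
  coeff-*-top {c ∷ f} {g} {zero} {n} d e = begin
    coeff (c ·ₚ g +ₚ (0# ∷ f *ₚ g)) n       ≈⟨ coeff-+ (c ·ₚ g) _ n ⟩
    coeff (c ·ₚ g) n + coeff (0# ∷ f *ₚ g) n  ≈⟨ +-cong (coeff-· c g n) (at 0∷f*g≈0 n) ⟩
    c * coeff g n + 0#                       ≈⟨ +-identityʳ _ ⟩
    c * coeff g n                            ∎
    where
    open SetoidReasoning setoid
    f≈0 : f ≈ₚ []
    f≈0 = coeffs λ n → above≈0 d (s≤s z≤n)
    0∷f*g≈0 : 0# ∷ f *ₚ g ≈ₚ []
    0∷f*g≈0 = ≈ₚ-trans (∷-cong refl (*ₚ-cong {g = g} f≈0 ≈ₚ-refl)) 0∷-zero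
  coeff-*-top {c ∷ f} {g} {suc m} {n} d e = begin
    coeff (c ·ₚ g +ₚ (0# ∷ f *ₚ g)) (suc (m ℕ.+ n))     ≈⟨ coeff-+ (c ·ₚ g) _ (suc (m ℕ.+ n)) ⟩
    coeff (c ·ₚ g) (suc (m ℕ.+ n)) + coeff (f *ₚ g) (m ℕ.+ n)
      ≈⟨ +-cong (coeff-· c g _) (coeff-*-top {f} (degree (leading≉0 d) (λ m<k → above≈0 d (s≤s m<k))) e) ⟩
    c * coeff g (suc (m ℕ.+ n)) + coeff f m * coeff g n  ≈⟨ +-congʳ (*-congˡ (above≈0 e (s≤s (ℕ.m≤n+m n m)))) ⟩
    c * 0# + coeff f m * coeff g n                       ≈⟨ +-congʳ (zeroʳ c) ⟩
    0# + coeff f m * coeff g n                           ≈⟨ +-identityˡ _ ⟩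
    coeff f m * coeff g n                                ∎
    where open SetoidReasoning setoid

  X-_ : Carrier → Poly
  X- x = - x ∷ 1# ∷ []

  -- Synthetic division: the intermediate values of Horner's scheme at x are the coefficients of the
  -- quotient by X - x.
  hornerQuotient : Poly → Carrier → Poly
  hornerQuotient []      x = []
  hornerQuotient (c ∷ f) x = f ⟨ x ⟩ ∷ hornerQuotient f x

  -- If f = (X - x)Q + r, then c + Xf = (X - x)(r + XQ) + (c + xr), so the remainder is again the
  -- value at x.
  horner-division : ∀ f x → (X- x) *ₚ hornerQuotient f x +ₚ [ f ⟨ x ⟩ ] ≈ₚ f
  horner-division []      x = +ₚ-cong (*ₚ-zeroʳ (X- x)) 0∷-zero
  horner-division (c ∷ f) x = begin
    (X- x) *ₚ (r ∷ Q) +ₚ [ c + x * r ]                    ≈⟨ +ₚ-cong (*ₚ-∷ (X- x) r Q) (≈ₚ-refl {[ c + x * r ]}) ⟩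
    (r ·ₚ (X- x) +ₚ (0# ∷ (X- x) *ₚ Q)) +ₚ [ c + x * r ]  ≈⟨ ∷-cong head≈ tail≈ ⟩
    c ∷ f                                                 ∎
    where
    r = f ⟨ x ⟩
    Q = hornerQuotient f x
    head≈ : (r * - x + 0#) + (c + x * r) ≈ c
    head≈ = begin
      (r * - x + 0#) + (c + x * r)  ≈⟨ +-cong (+-identityʳ _) (+-comm c _) ⟩
      r * - x + (x * r + c)         ≈⟨ +-assoc _ _ _ ⟨
      (r * - x + x * r) + c         ≈⟨ +-congʳ (+-cong (sym (-‿distribʳ-* r x)) (*-comm x r)) ⟩
      (- (r * x) + r * x) + c       ≈⟨ +-congʳ (-‿inverseˡ _) ⟩
      0# + c                        ≈⟨ +-identityˡ c ⟩
      c                             ∎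
      where open SetoidReasoning setoid
    open SetoidReasoning ≈ₚ-setoid
    tail≈ : ([ r * 1# ] +ₚ (X- x) *ₚ Q) +ₚ [] ≈ₚ f
    tail≈ = begin
      ([ r * 1# ] +ₚ (X- x) *ₚ Q) +ₚ []  ≈⟨ +ₚ-identityʳ _ ⟩
      [ r * 1# ] +ₚ (X- x) *ₚ Q          ≈⟨ +ₚ-comm [ r * 1# ] _ ⟩
      (X- x) *ₚ Q +ₚ [ r * 1# ]          ≈⟨ +ₚ-cong ≈ₚ-refl (∷-cong (*-identityʳ r) ≈ₚ-refl) ⟩
      (X- x) *ₚ Q +ₚ [ r ]               ≈⟨ horner-division f x ⟩
      f                                  ∎

  root⇒X-∣ : ∀ f x → f ⟨ x ⟩ ≈ 0# → (X- x) ∣ f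
  root⇒X-∣ f x fx≈0 = hornerQuotient f x , (begin
    Q *ₚ (X- x)                   ≈⟨ *ₚ-comm Q (X- x) ⟩
    (X- x) *ₚ Q                   ≈⟨ +ₚ-identityʳ _ ⟨
    (X- x) *ₚ Q +ₚ []             ≈⟨ +ₚ-cong ≈ₚ-refl (≈ₚ-trans (∷-cong fx≈0 ≈ₚ-refl) 0∷-zero) ⟨
    (X- x) *ₚ Q +ₚ [ f ⟨ x ⟩ ]    ≈⟨ horner-division f x ⟩
    f                             ∎)
    where
    open SetoidReasoning ≈ₚ-setoid
    Q = hornerQuotient f x

  -- Together with `combination-inverse`, this shows that for V = B + cA the pairs V, A and A, B
  -- have the same common divisors.
  ∣-combination : ∀ {f g h d} c → h ≈ₚ g +ₚ c ·ₚ f → d ∣ f → d ∣ g → d ∣ h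
  ∣-combination {f} {g} {h} {d} c h≈ (k , kd≈f) (l , ld≈g) = l +ₚ c ·ₚ k , (begin
    (l +ₚ c ·ₚ k) *ₚ d          ≈⟨ *ₚ-distribʳ d l (c ·ₚ k) ⟩
    l *ₚ d +ₚ (c ·ₚ k) *ₚ d     ≈⟨ +ₚ-cong ld≈g (·ₚ-*ₚ c k d) ⟩
    g +ₚ c ·ₚ (k *ₚ d)          ≈⟨ +ₚ-cong ≈ₚ-refl (·ₚ-cong refl kd≈f) ⟩
    g +ₚ c ·ₚ f                 ≈⟨ h≈ ⟨
    h                           ∎)
    where open SetoidReasoning ≈ₚ-setoid

  coeff-combination : ∀ {f g h} c → h ≈ₚ g +ₚ c ·ₚ f → ∀ n → coeff h n ≈ coeff g n + c * coeff f n
  coeff-combination {f} {g} c h≈ n =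
    trans (at h≈ n) (trans (coeff-+ g (c ·ₚ f) n) (+-congˡ (coeff-· c f n)))

  combination-inverse : ∀ {f g h} c → h ≈ₚ g +ₚ c ·ₚ f → g ≈ₚ h +ₚ (- c) ·ₚ f
  combination-inverse {f} {g} {h} c h≈ = coeffs λ n → sym (begin
    coeff (h +ₚ (- c) ·ₚ f) n                            ≈⟨ coeff-combination {f} {h} (- c) ≈ₚ-refl n ⟩
    coeff h n + - c * coeff f n                          ≈⟨ +-cong (coeff-combination {f} {g} c h≈ n) (sym (-‿distribˡ-* c _)) ⟩
    (coeff g n + c * coeff f n) + - (c * coeff f n)      ≈⟨ +-assoc _ _ _ ⟩
    coeff g n + (c * coeff f n + - (c * coeff f n))      ≈⟨ +-congˡ (-‿inverseʳ _) ⟩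
    coeff g n + 0#                                       ≈⟨ +-identityʳ _ ⟩
    coeff g n                                            ∎)
    where open SetoidReasoning setoid

  *ₚ-combination : ∀ {f g h} c k → h ≈ₚ g +ₚ c ·ₚ f → h *ₚ k ≈ₚ g *ₚ k +ₚ c ·ₚ (f *ₚ k)
  *ₚ-combination {f} {g} {h} c k h≈ = begin
    h *ₚ k                        ≈⟨ *ₚ-cong h≈ (≈ₚ-refl {k}) ⟩
    (g +ₚ c ·ₚ f) *ₚ k            ≈⟨ *ₚ-distribʳ k g (c ·ₚ f) ⟩
    g *ₚ k +ₚ (c ·ₚ f) *ₚ k       ≈⟨ +ₚ-cong ≈ₚ-refl (·ₚ-*ₚ c f k) ⟩
    g *ₚ k +ₚ c ·ₚ (f *ₚ k)       ∎
    where open SetoidReasoning ≈ₚ-setoid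

module RationalFunctionProperties {a ℓ₁ ℓ₂} (F : HeytingField a ℓ₁ ℓ₂) {q : ℕ}
  (size : HasSize (HeytingField.setoid F) q) where

  open RationalFunctions F size
  open CommutativeRing commutativeRing
  open PolynomialProperties commutativeRing
  open RingProperties ring using (-‿involutive)
  open GroupProperties (CommutativeRing.+-group polynomialRing) using () renaming (∙-cancelʳ to +ₚ-cancelʳ)
  open GroupProperties +-group using (∙-cancelʳ)
  open SemiringDivisibility (CommutativeRing.semiring polynomialRing) using (_∣_; _,_)
  open import Algebra.Properties.CommutativeSemigroup *-commutativeSemigroup
    using (x∙yz≈xz∙y; xy∙z≈xz∙y)

  -- The reciprocal and translations on P¹

  ÷-zero : ∀ {x y} → y ≈ 0# → x ÷ y ≈¹ ∞
  ÷-zero {y = y} y≈0 with y ≟ 0#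
  ... | yes _   = ¹.refl
  ... | no  y≉0 = contradiction y≈0 y≉0

  -- Lets a quotient be recognised by multiplying back, without mention of the chosen inverse of y.
  ÷-nonzero : ∀ {w x y} → y ≉ 0# → w * y ≈ x → x ÷ y ≈¹ just w
  ÷-nonzero {w} {x} {y} y≉0 wy≈x with y ≟ 0#
  ... | yes y≈0 = contradiction y≈0 y≉0
  ... | no  y≉0 = let z , zy≈1 = inverse y≉0 in Pointwise.just (begin
    x * z        ≈⟨ *-congʳ wy≈x ⟨
    w * y * z    ≈⟨ x∙yz≈xz∙y w z y ⟨
    w * (z * y)  ≈⟨ *-congˡ zy≈1 ⟩
    w * 1#       ≈⟨ *-identityʳ w ⟩
    w            ∎)
    where open SetoidReasoning setoid

  reciprocal : P¹ → P¹
  reciprocal ∞        = just 0#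
  reciprocal (just x) = 1# ÷ x

  reciprocal-cong : ∀ {s t} → s ≈¹ t → reciprocal s ≈¹ reciprocal t
  reciprocal-cong (Pointwise.just x≈y) = ÷-cong refl x≈y
  reciprocal-cong Pointwise.nothing    = ¹.refl

  -- The case 0 ÷ 0 has to be excluded: it evaluates to ∞, whose reciprocal is 0, while the
  -- right-hand side would still be ∞.
  reciprocal-÷ : ∀ {x y} → ¬ (x ≈ 0# × y ≈ 0#) → reciprocal (x ÷ y) ≈¹ y ÷ x
  reciprocal-÷ {x} {y} ¬0÷0 with y ≟ 0# | x ≟ 0#
  ... | yes y≈0 | yes x≈0 = contradiction (x≈0 , y≈0) ¬0÷0
  ... | yes y≈0 | no  x≉0 = Pointwise.just (sym (trans (*-congʳ y≈0) (zeroˡ _)))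
  ... | no  y≉0 | yes x≈0 = ÷-zero (trans (*-congʳ x≈0) (zeroˡ _))
  ... | no  y≉0 | no  x≉0 = ÷-nonzero
    (λ xz≈0 → 1≉0 (trans (sym zy≈1) (trans (*-congʳ (*-cancelˡ-≉0 x≉0 xz≈0)) (zeroˡ y))))
    (begin
      y * w * (x * z)     ≈⟨ *-assoc y w (x * z) ⟩
      y * (w * (x * z))   ≈⟨ *-congˡ (*-assoc w x z) ⟨
      y * (w * x * z)     ≈⟨ *-congˡ (*-congʳ wx≈1) ⟩
      y * (1# * z)        ≈⟨ *-congˡ (*-identityˡ z) ⟩
      y * z               ≈⟨ *-comm y z ⟩
      z * y               ≈⟨ zy≈1 ⟩
      1#                  ∎)
    where
    open SetoidReasoning setoid
    z = proj₁ (inverse y≉0)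
    zy≈1 = proj₂ (inverse y≉0)
    w = proj₁ (inverse x≉0)
    wx≈1 = proj₂ (inverse x≉0)

  reciprocal-involutive : ∀ s → reciprocal (reciprocal s) ≈¹ s
  reciprocal-involutive ∞        = ÷-zero refl
  reciprocal-involutive (just x) = ¹.trans (reciprocal-÷ (1≉0 ∘ proj₁)) (÷-nonzero 1≉0 (*-identityʳ x))

  translate : Carrier → P¹ → P¹
  translate c = Maybe.map (_+ c)

  translate-cong : ∀ c {s t} → s ≈¹ t → translate c s ≈¹ translate c t
  translate-cong c (Pointwise.just x≈y) = Pointwise.just (+-congʳ x≈y)
  translate-cong c Pointwise.nothing    = ¹.refl

  translate-inverse : ∀ {c d} → c + d ≈ 0# → ∀ s → translate d (translate c s) ≈¹ s
  translate-inverse c+d≈0 ∞        = ¹.refl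
  translate-inverse c+d≈0 (just x) = Pointwise.just
    (trans (+-assoc x _ _) (trans (+-congˡ c+d≈0) (+-identityʳ x)))

  translate-÷ : ∀ c x y → translate c (x ÷ y) ≈¹ (x + c * y) ÷ y
  translate-÷ c x y with y ≟ 0#
  ... | yes _   = ¹.refl
  ... | no  y≉0 = let z , zy≈1 = inverse y≉0 in Pointwise.just (sym (begin
    (x + c * y) * z      ≈⟨ distribʳ z x (c * y) ⟩
    x * z + c * y * z    ≈⟨ +-congˡ (x∙yz≈xz∙y c z y) ⟨
    x * z + c * (z * y)  ≈⟨ +-congˡ (*-congˡ zy≈1) ⟩
    x * z + c * 1#       ≈⟨ +-congˡ (*-identityʳ c) ⟩
    x * z + c            ∎))
    where open SetoidReasoning setoid

  -- The map t ↦ 1 / t + c, which undoes t ↦ 1 / (t - c). It recovers V / U from its reduction.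
  reciprocal+ : Carrier → Inverse P¹-setoid P¹-setoid
  reciprocal+ c = Compose.inverse
    (strict-inverse P¹-setoid P¹-setoid reciprocal reciprocal
      (λ _ _ → reciprocal-cong) (λ _ _ → reciprocal-cong) reciprocal-involutive reciprocal-involutive)
    (strict-inverse P¹-setoid P¹-setoid (translate c) (translate (- c))
      (λ _ _ → translate-cong c) (λ _ _ → translate-cong (- c))
      (translate-inverse (-‿inverseˡ c)) (translate-inverse (-‿inverseʳ c)))

  Bijective-∘ : (I : Inverse P¹-setoid P¹-setoid) {f g : P¹ → P¹} → (∀ s → g s ≈¹ Inverse.to I (f s)) →
    Bijective _≈¹_ _≈¹_ f → Bijective _≈¹_ _≈¹_ g
  Bijective-∘ I g≗I∘f f-bijective = Bijective-resp (λ s → ¹.sym (g≗I∘f s))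
    (Compose.bijective _≈¹_ _≈¹_ _≈¹_ f-bijective (Bijection.bijective (Inverse⇒Bijection I)))

  -- The reduction of V / U with deg V = deg U

  ∣1⇒degree-0 : ∀ {f n} → Degree f n → f ∣ [ 1# ] → n ≡ 0
  ∣1⇒degree-0 {n = zero}  d _ = ≡.refl
  ∣1⇒degree-0 {f} {suc n} d (k , kf≈1) = contradiction
    (*ₚ-boundˡ {f = [ 1# ]} {g = k} {h = f} (degree 1≉0 λ { (s≤s _) → refl })
      (≈ₚ-trans (*ₚ-comm f k) kf≈1) (s≤s z≤n))
    (leading≉0 d)

  -- At a common root x the linear polynomial X - x would divide both f and g, hence 1, although its
  -- degree is 1.
  coprime⇒no-common-root : ∀ {f g} → Coprime f g → ∀ x → ¬ (f ⟨ x ⟩ ≈ 0# × g ⟨ x ⟩ ≈ 0#)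
  coprime⇒no-common-root {f} {g} coprime x (fx≈0 , gx≈0) = contradiction
    (∣1⇒degree-0 (degree {X- x} {1} 1≉0 λ { (s≤s (s≤s _)) → refl })
      (coprime (root⇒X-∣ f x fx≈0) (root⇒X-∣ g x gx≈0)))
    λ ()

  -- B ends below position v. Consequently c is the ratio of the leading coefficients, that is, the
  -- value of V / A at ∞.
  degree-combination : ∀ {V A B v u} c → V ≈ₚ B +ₚ c ·ₚ A → Degree A v → Degree B u → u ℕ.< v →
    coeff V v ≈ c * coeff A v
  degree-combination {V} {A} {B} {v} c V≈ dA dB u<v = begin
    coeff V v                     ≈⟨ coeff-combination {A} {B} c V≈ v ⟩
    coeff B v + c * coeff A v     ≈⟨ +-congʳ (above≈0 dB u<v) ⟩
    0# + c * coeff A v            ≈⟨ +-identityˡ _ ⟩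
    c * coeff A v                 ∎
    where open SetoidReasoning setoid

  -- At a finite point V / A = B / A + c, and B / A is the reciprocal of A / B because coprimality
  -- rules out 0 ÷ 0. At ∞ the function A / B has value ∞ as u < v, which is sent to 0 + c, and c is
  -- also the ratio of leading coefficients of V and A.
  evaluate-reciprocal+ : ∀ {V A B v u} c → V ≈ₚ B +ₚ c ·ₚ A → Degree A v → Degree B u → u ℕ.< v →
    Coprime A B → ∀ s → evaluate v v V A s ≈¹ Inverse.to (reciprocal+ c) (evaluate v u A B s)
  evaluate-reciprocal+ {V} {A} {B} {v} {u} c V≈ dA dB u<v coprime ∞ with ℕ.<-cmp v v | ℕ.<-cmp v u
  ... | tri< v<v _ _ | _            = contradiction v<v (ℕ.<-irrefl ≡.refl)
  ... | tri> _ _ v<v | _            = contradiction v<v (ℕ.<-irrefl ≡.refl)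
  ... | tri≈ _ _ _   | tri< _ _ u≮v = contradiction u<v u≮v
  ... | tri≈ _ _ _   | tri≈ _ _ u≮v = contradiction u<v u≮v
  ... | tri≈ _ _ _   | tri> _ _ _   = ÷-nonzero (leading≉0 dA)
    (trans (*-congʳ (+-identityˡ c)) (sym (degree-combination {A = A} {B} c V≈ dA dB u<v)))
  evaluate-reciprocal+ {V} {A} {B} {v} {u} c V≈ dA dB u<v coprime (just x) = begin
    V ⟨ x ⟩ ÷ A ⟨ x ⟩                           ≈⟨ ÷-cong Vx≈ refl ⟩
    (B ⟨ x ⟩ + c * A ⟨ x ⟩) ÷ A ⟨ x ⟩           ≈⟨ translate-÷ c (B ⟨ x ⟩) (A ⟨ x ⟩) ⟨
    translate c (B ⟨ x ⟩ ÷ A ⟨ x ⟩)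
      ≈⟨ translate-cong c (reciprocal-÷ (coprime⇒no-common-root {A} {B} coprime x)) ⟨
    translate c (reciprocal (A ⟨ x ⟩ ÷ B ⟨ x ⟩))  ∎
    where
    open SetoidReasoning P¹-setoid
    Vx≈ : V ⟨ x ⟩ ≈ B ⟨ x ⟩ + c * A ⟨ x ⟩
    Vx≈ = trans (⟨⟩-cong {V} V≈ refl) (trans (⟨⟩-+ B (c ·ₚ A) x) (+-congˡ (⟨⟩-· c A x)))

  -- As c is nonzero, cA keeps degree v and dominates B, so V has degree exactly v. The permutation
  -- property is carried over by `reciprocal+ c`.
  PRF-from-remainder : ∀ {V A B v u} c → c ≉ 0# → V ≈ₚ B +ₚ c ·ₚ A → u ℕ.< v →
    IsPRF v u A B → IsPRF v v V A
  PRF-from-remainder {V} {A} {B} {v} c c≉0 V≈ u<v r = record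
    { degree-V = degree
        (λ Vv≈0 → leading≉0 degree-V (*-cancelˡ-≉0 c≉0
          (trans (sym (degree-combination {A = A} {B} c V≈ degree-V degree-U u<v)) Vv≈0)))
        (λ {m} v<m → begin
          coeff V m                   ≈⟨ coeff-combination {A} {B} c V≈ m ⟩
          coeff B m + c * coeff A m   ≈⟨ +-cong (above≈0 degree-U (ℕ.<-trans u<v v<m)) (*-congˡ (above≈0 degree-V v<m)) ⟩
          0# + c * 0#                 ≈⟨ +-identityˡ _ ⟩
          c * 0#                      ≈⟨ zeroʳ c ⟩
          0#                          ∎)
    ; degree-U = degree-V
    -- A common divisor of V and A divides B = V - cA.
    ; coprime  = λ z∣V z∣A → coprime z∣A (∣-combination (- c) (combination-inverse {A} {B} c V≈) z∣A z∣V)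
    ; permutes = Bijective-∘ (reciprocal+ c)
        (evaluate-reciprocal+ c V≈ degree-V degree-U u<v (λ {z} → coprime {z})) permutes
    }
    where
    open IsPRF r
    open SetoidReasoning setoid

  -- The permutation property is carried back by the inverse of `reciprocal+ c`. Coprimality of A
  -- and B is settled first, since the comparison of the two evaluations rests on it.
  PRF-remainder : ∀ {V A B v u} c → V ≈ₚ B +ₚ c ·ₚ A → u ℕ.< v → Degree B u →
    IsPRF v v V A → IsPRF v u A B
  PRF-remainder {V} {A} {B} {v} {u} c V≈ u<v dB r = record
    { degree-V = degree-U
    ; degree-U = dB
    ; coprime  = λ {z} → coprime-AB {z}
    ; permutes = Bijective-∘ (Symmetry.inverse I)
        (λ s → ¹.sym (Inverse.inverseʳ I (evaluate-reciprocal+ c V≈ degree-U dB u<v (λ {z} → coprime-AB {z}) s)))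
        permutes
    }
    where
    open IsPRF r
    I = reciprocal+ c
    coprime-AB : Coprime A B
    coprime-AB z∣A z∣B = coprime (∣-combination c V≈ z∣A z∣B) z∣A

  -- Cross-multiplication gives VA′ = BA′ + cAA′ and V′A = B′A + c′A′A. The last terms agree, so VA′
  -- = V′A amounts to BA′ = B′A; the converse below cancels them.
  ≃-combination⇒ : ∀ {V A B V′ A′ B′ c c′} → V ≈ₚ B +ₚ c ·ₚ A → V′ ≈ₚ B′ +ₚ c′ ·ₚ A′ → c ≈ c′ →
    (A , B) ≃ (A′ , B′) → (V , A) ≃ (V′ , A′)
  ≃-combination⇒ {V} {A} {B} {V′} {A′} {B′} {c} {c′} V≈ V′≈ c≈c′ AB′≈A′B = begin
    V *ₚ A′                        ≈⟨ *ₚ-combination {A} {B} c A′ V≈ ⟩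
    B *ₚ A′ +ₚ c ·ₚ (A *ₚ A′)      ≈⟨ +ₚ-cong BA′≈B′A (·ₚ-cong c≈c′ (*ₚ-comm A A′)) ⟩
    B′ *ₚ A +ₚ c′ ·ₚ (A′ *ₚ A)     ≈⟨ *ₚ-combination {A′} {B′} c′ A V′≈ ⟨
    V′ *ₚ A                        ∎
    where
    open SetoidReasoning ≈ₚ-setoid
    BA′≈B′A : B *ₚ A′ ≈ₚ B′ *ₚ A
    BA′≈B′A = ≈ₚ-trans (*ₚ-comm B A′) (≈ₚ-trans (≈ₚ-sym AB′≈A′B) (*ₚ-comm A B′))

  ≃-combination⇐ : ∀ {V A B V′ A′ B′ c c′} → V ≈ₚ B +ₚ c ·ₚ A → V′ ≈ₚ B′ +ₚ c′ ·ₚ A′ → c ≈ c′ →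
    (V , A) ≃ (V′ , A′) → (A , B) ≃ (A′ , B′)
  ≃-combination⇐ {V} {A} {B} {V′} {A′} {B′} {c} {c′} V≈ V′≈ c≈c′ VA′≈V′A =
    ≈ₚ-trans (*ₚ-comm A B′) (≈ₚ-trans
      (+ₚ-cancelʳ (c ·ₚ (A *ₚ A′)) (B′ *ₚ A) (B *ₚ A′) (≈ₚ-sym (begin
        B *ₚ A′ +ₚ c ·ₚ (A *ₚ A′)      ≈⟨ *ₚ-combination {A} {B} c A′ V≈ ⟨
        V *ₚ A′                        ≈⟨ VA′≈V′A ⟩
        V′ *ₚ A                        ≈⟨ *ₚ-combination {A′} {B′} c′ A V′≈ ⟩
        B′ *ₚ A +ₚ c′ ·ₚ (A′ *ₚ A)     ≈⟨ +ₚ-cong ≈ₚ-refl (·ₚ-cong c≈c′ (*ₚ-comm A A′)) ⟨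
        B′ *ₚ A +ₚ c ·ₚ (A *ₚ A′)      ∎)))
      (*ₚ-comm B A′))
    where open SetoidReasoning ≈ₚ-setoid

  -- Both facts come from the top terms of the two equal cross products. The degrees separate the
  -- sets P_{v,u} for different u, and the coefficients show that the value at ∞ depends on the
  -- fraction alone.
  ≃-leading : ∀ {V U V′ U′ v u v′ u′} → Degree V v → Degree U u → Degree V′ v′ → Degree U′ u′ →
    (V , U) ≃ (V′ , U′) → v ℕ.+ u′ ≡ v′ ℕ.+ u × coeff V v * coeff U′ u′ ≈ coeff V′ v′ * coeff U u
  ≃-leading {V} {U} {V′} {U′} {v} {u} {v′} {u′} dV dU dV′ dU′ VU′≈V′U = degrees≡ , (begin
    coeff V v * coeff U′ u′        ≈⟨ coeff-*-top {V} {U′} dV dU′ ⟨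
    coeff (V *ₚ U′) (v ℕ.+ u′)     ≈⟨ at VU′≈V′U (v ℕ.+ u′) ⟩
    coeff (V′ *ₚ U) (v ℕ.+ u′)     ≡⟨ ≡.cong (coeff (V′ *ₚ U)) degrees≡ ⟩
    coeff (V′ *ₚ U) (v′ ℕ.+ u)     ≈⟨ coeff-*-top {V′} {U} dV′ dU ⟩
    coeff V′ v′ * coeff U u        ∎)
    where
    open SetoidReasoning setoid
    degrees≡ : v ℕ.+ u′ ≡ v′ ℕ.+ u
    degrees≡ = Degree-unique (Degree-resp VU′≈V′U (*ₚ-degree {V} {U′} dV dU′)) (*ₚ-degree {V′} {U} dV′ dU)

  -- The union of the P_{v,u} over u < n and its size.

  PRF< : ℕ → ℕ → Setoid (a ⊔ ℓ₁) ℓ₁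
  PRF< v n = record
    { Carrier       = Σ (Poly × Poly) λ (A , B) → ∃ λ u → u ℕ.< n × IsPRF v u A B
    ; _≈_           = _≃_ on proj₁
    ; isEquivalence = record
      { refl  = ≈ₚ-refl
      ; sym   = ≈ₚ-sym
      ; trans = λ { {(A , B) , _} {(A′ , B′) , _ , _ , r} {(A″ , B″) , _} →
          ≃-trans {A} {B} {A′} {B′} {A″} {B″} (IsPRF.degree-U r) }
      }
    }

  -- The numerators share the degree v, so the denominators of equal fractions share theirs. Hence
  -- the union in `PRF<` is disjoint although its equality ignores u.
  PRF-≃⇒denominator-degree-≡ : ∀ {A B A′ B′ v u u′} → IsPRF v u A B → IsPRF v u′ A′ B′ →
    (A , B) ≃ (A′ , B′) → u′ ≡ u
  PRF-≃⇒denominator-degree-≡ {A} {B} {A′} {B′} {v} r r′ e = ℕ.+-cancelˡ-≡ v _ _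
    (proj₁ (≃-leading {A} {B} {A′} {B′} (degree-V r) (degree-U r) (degree-V r′) (degree-U r′) e))
    where open IsPRF

  PRF<-suc : ∀ v n → Inverse (PRF< v (suc n)) (PRF< v n ⊎ₛ PRF-setoid v n)
  PRF<-suc v n = inverse-from-relation (PRF< v (suc n)) (PRF< v n ⊎ₛ PRF-setoid v n)
    SameFraction functional injective total surjective
    where
    open Setoid
    SameFraction : Carrier (PRF< v (suc n)) → Carrier (PRF< v n ⊎ₛ PRF-setoid v n) → Set a
    SameFraction x (inj₁ y) = proj₁ x ≡ proj₁ y
    SameFraction x (inj₂ y) = proj₁ x ≡ proj₁ y

    functional : ∀ {x x′ y y′} → SameFraction x y → SameFraction x′ y′ →
      proj₁ x ≃ proj₁ x′ → _≈_ (PRF< v n ⊎ₛ PRF-setoid v n) y y′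
    functional {y = inj₁ _} {inj₁ _} ≡.refl ≡.refl e = ⊎.inj₁ e
    functional {y = inj₂ _} {inj₂ _} ≡.refl ≡.refl e = ⊎.inj₂ e
    -- A fraction lying in both summands would have a denominator of degree n and of degree below n.
    functional {y = inj₁ (_ , _ , u<n , r)} {inj₂ (_ , r′)} ≡.refl ≡.refl e =
      contradiction u<n (ℕ.<-irrefl (≡.sym (PRF-≃⇒denominator-degree-≡ r r′ e)))
    functional {y = inj₂ (_ , r)} {inj₁ (_ , _ , u<n , r′)} ≡.refl ≡.refl e =
      contradiction u<n (ℕ.<-irrefl (PRF-≃⇒denominator-degree-≡ r r′ e))

    injective : ∀ {x x′ y y′} → SameFraction x y → SameFraction x′ y′ →
      _≈_ (PRF< v n ⊎ₛ PRF-setoid v n) y y′ → proj₁ x ≃ proj₁ x′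
    injective ≡.refl ≡.refl (⊎.inj₁ e) = e
    injective ≡.refl ≡.refl (⊎.inj₂ e) = e

    total : ∀ x → ∃ (SameFraction x)
    total (f , u , u<1+n , r) with ℕ.m<1+n⇒m<n∨m≡n u<1+n
    ... | inj₁ u<n    = inj₁ (f , u , u<n , r) , ≡.refl
    ... | inj₂ ≡.refl = inj₂ (f , r) , ≡.refl

    surjective : ∀ y → ∃ λ x → SameFraction x y
    surjective (inj₁ (f , u , u<n , r)) = (f , u , ℕ.m<n⇒m<1+n u<n , r) , ≡.refl
    surjective (inj₂ (f , r))           = (f , n , ℕ.≤-refl , r) , ≡.refl

  PRF<-size : ∀ v n → HasSize (PRF< v n) (sum (map (N v) (upTo n)))
  PRF<-size v zero    = record
    { to = λ { (_ , _ , () , _) } ; from = λ () ; to-cong = λ { {_ , _ , () , _} } ; from-cong = λ { {()} }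
    ; inverse = (λ { {()} }) , λ { {_ , _ , () , _} } }
  PRF<-size v (suc n) = ≡.subst (HasSize (PRF< v (suc n))) (≡.sym sum-suc)
    (Compose.inverse (PRF<-suc v n) (HasSize-⊎ (PRF<-size v n) (proj₂ (PRF-finite v n))))
    where
    open ≡.≡-Reasoning
    sum-suc : sum (map (N v) (upTo (suc n))) ≡ sum (map (N v) (upTo n)) ℕ.+ N v n
    sum-suc = begin
      -- `upTo` unfolds at the front, whereas `PRF<-suc` splits off the largest degree, so n is
      -- first moved to the end of the list.
      sum (map (N v) (upTo (suc n)))                 ≡⟨ ≡.cong (sum ∘ map (N v)) (List.upTo-∷ʳ n) ⟨
      sum (map (N v) (upTo n ∷ʳ n))                  ≡⟨ ≡.cong sum (List.map-++ (N v) (upTo n) [ n ]) ⟩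
      sum (map (N v) (upTo n) ∷ʳ N v n)              ≡⟨ ListAction.sum-++ (map (N v) (upTo n)) [ N v n ] ⟩
      sum (map (N v) (upTo n)) ℕ.+ (N v n ℕ.+ 0)     ≡⟨ ≡.cong (sum (map (N v) (upTo n)) ℕ.+_) (ℕ.+-identityʳ _) ⟩
      sum (map (N v) (upTo n)) ℕ.+ N v n             ∎

  -- The bijection from P_{v,v} to nonzero scalars paired with reduced fractions.

  remainder : ∀ {V U v} → 0 ℕ.< v → IsPRF v v V U →
    ∃₂ λ c B → c ≉ 0# × V ≈ₚ B +ₚ c ·ₚ U × ∃ λ u → u ℕ.< v × IsPRF v u U B
  remainder {V} {U} {v} 0<v r with inverse (leading≉0 (IsPRF.degree-U r))
  ... | z , zu≈1 = c , B , c≉0 , V≈ , B-PRF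
    where
    open IsPRF r
    -- With z the inverse of the leading coefficient of U, this is the value of V / U at ∞.
    c = z * coeff V v
    B = V +ₚ (- c) ·ₚ U

    V≈ : V ≈ₚ B +ₚ c ·ₚ U
    V≈ = ≈ₚ-trans (combination-inverse {U} {V} (- c) ≈ₚ-refl)
      (+ₚ-cong (≈ₚ-refl {B}) (·ₚ-cong (-‿involutive c) (≈ₚ-refl {U})))

    cu≈v : c * coeff U v ≈ coeff V v
    cu≈v = trans (xy∙z≈xz∙y z _ _) (trans (*-congʳ zu≈1) (*-identityˡ _))

    c≉0 : c ≉ 0#
    c≉0 c≈0 = leading≉0 degree-V (trans (sym cu≈v) (trans (*-congʳ c≈0) (zeroˡ _)))

    c*U≈V : ∀ {m} → v ℕ.≤ m → c * coeff U m ≈ coeff V m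
    c*U≈V v≤m with ℕ.m≤n⇒m<n∨m≡n v≤m
    ... | inj₁ v<m    = trans (*-congˡ (above≈0 degree-U v<m)) (trans (zeroʳ c) (sym (above≈0 degree-V v<m)))
    ... | inj₂ ≡.refl = cu≈v

    B-vanishes : ∀ {m} → v ℕ.≤ m → coeff B m ≈ 0#
    -- After adding the coefficient of cU, the left side becomes that of V, which agrees with that
    -- of cU from position v on.
    B-vanishes {m} v≤m = ∙-cancelʳ (c * coeff U m) _ _ (begin
      coeff B m + c * coeff U m  ≈⟨ coeff-combination {U} {B} c V≈ m ⟨
      coeff V m                  ≈⟨ c*U≈V v≤m ⟨
      c * coeff U m              ≈⟨ +-identityˡ _ ⟨
      0# + c * coeff U m         ∎)
      where open SetoidReasoning setoid

    B-PRF : ∃ λ u → u ℕ.< v × IsPRF v u U B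
    B-PRF with zero⊎degree B
    ... | inj₂ (u , dB) = u , u<v , PRF-remainder c V≈ u<v dB r
      where
      u<v : u ℕ.< v
      u<v = ℕ.≰⇒> λ v≤u → leading≉0 dB (B-vanishes v≤u)
    -- If V = cU, then U is a common divisor of V and U, so it divides 1 and has degree 0, against 0
    -- < v.
    ... | inj₁ B≈0 = contradiction (≡.sym (∣1⇒degree-0 degree-U (coprime U∣V U∣U))) (ℕ.<⇒≢ 0<v)
      where
      U∣U : U ∣ U
      U∣U = [ 1# ] , *ₚ-identityˡ U
      U∣V : U ∣ V
      U∣V = ∣-combination c V≈ U∣U ([] , ≈ₚ-sym B≈0)

  -- The relation speaks of representatives: U is literally A, and V is B + cA. It respects equality
  -- of fractions because c is determined by V / U, after which the two `≃-combination` lemmas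
  -- apply.
  PRF↔value-at-∞×remainder : ∀ {v} → 0 ℕ.< v →
    Inverse (PRF-setoid v v) ((setoid Without 0#) ×ₛ PRF< v v)
  PRF↔value-at-∞×remainder {v} 0<v = inverse-from-relation (PRF-setoid v v) _
    (λ { ((V , U) , _) ((c , _) , (A , B) , _) → U ≡ A × V ≈ₚ B +ₚ c ·ₚ A })
    (λ { {(V , U) , r} {(V′ , U′) , r′} {(c , _) , (_ , B) , _ , u<v , s} {(c′ , _) , (_ , B′) , _ , u′<v , s′}
         (≡.refl , V≈) (≡.refl , V′≈) e →
         let c≈c′ = value-at-∞ {V} {U} {B} {V′} {U′} {B′} V≈ V′≈ r r′ s s′ u<v u′<v e
         in c≈c′ , ≃-combination⇐ {B = B} {B′ = B′} V≈ V′≈ c≈c′ e })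
    (λ { {y = _ , (_ , B) , _} {y′ = _ , (_ , B′) , _} (≡.refl , V≈) (≡.refl , V′≈) (c≈c′ , e) →
         ≃-combination⇒ {B = B} {B′ = B′} V≈ V′≈ c≈c′ e })
    (λ { ((V , U) , r) → let c , B , c≉0 , V≈ , B-PRF = remainder 0<v r in
         ((c , c≉0) , (U , B) , B-PRF) , ≡.refl , V≈ })
    (λ { ((c , c≉0) , (A , B) , u , u<v , r) →
         ((B +ₚ c ·ₚ A , A) , PRF-from-remainder c c≉0 ≈ₚ-refl u<v r) , ≡.refl , ≈ₚ-refl })
    where
    open IsPRF
    value-at-∞ : ∀ {V U B V′ U′ B′ c c′ u u′} → V ≈ₚ B +ₚ c ·ₚ U → V′ ≈ₚ B′ +ₚ c′ ·ₚ U′ →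
      IsPRF v v V U → IsPRF v v V′ U′ → IsPRF v u U B → IsPRF v u′ U′ B′ → u ℕ.< v → u′ ℕ.< v →
      (V , U) ≃ (V′ , U′) → c ≈ c′
    value-at-∞ {V} {U} {B} {V′} {U′} {B′} {c} {c′} V≈ V′≈ r r′ s s′ u<v u′<v e =
      -- Both c and c′ are recognised as one quotient in P¹, with denominator the nonzero product of
      -- the leading coefficients of U and U′; `≃-leading` makes the numerators agree.
      Pointwise.drop-just (¹.trans (¹.sym (÷-nonzero {c} uu′≉0 (begin
        c * (coeff U v * coeff U′ v)    ≈⟨ *-assoc c _ _ ⟨
        c * coeff U v * coeff U′ v      ≈⟨ *-congʳ (degree-combination {A = U} {B} c V≈ (degree-U r) (degree-U s) u<v) ⟨
        coeff V v * coeff U′ v          ∎)))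
      (÷-nonzero {c′} uu′≉0 (begin
        c′ * (coeff U v * coeff U′ v)   ≈⟨ x∙yz≈xz∙y c′ _ _ ⟩
        c′ * coeff U′ v * coeff U v     ≈⟨ *-congʳ (degree-combination {A = U′} {B′} c′ V′≈ (degree-U r′) (degree-U s′) u′<v) ⟨
        coeff V′ v * coeff U v          ≈⟨ proj₂ (≃-leading {V} {U} {V′} {U′} (degree-V r) (degree-U r) (degree-V r′) (degree-U r′) e) ⟨
        coeff V v * coeff U′ v          ∎)))
      where
      open SetoidReasoning setoid
      uu′≉0 : coeff U v * coeff U′ v ≉ 0#
      uu′≉0 uu′≈0 = leading≉0 (degree-U r′) (*-cancelˡ-≉0 (leading≉0 (degree-U r)) uu′≈0)

-- Writing the order of the field as `suc q` makes q the number of nonzero scalars and avoids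
-- subtraction. The bijection then gives two sizes for P_{v,v}, which must coincide.
N-diagonal : ∀ {a ℓ₁ ℓ₂} (F : HeytingField a ℓ₁ ℓ₂) {q} (size : HasSize (HeytingField.setoid F) (suc q)) →
  let open RationalFunctions F size in
  ∀ {v} → 0 ℕ.< v → N v v ≡ q ℕ.* sum (map (N v) (upTo v))
N-diagonal F size {v} 0<v = HasSize-unique (proj₂ (PRF-finite v v))
  (Compose.inverse (PRF↔value-at-∞×remainder 0<v)
    (HasSize-× (HasSize-Without (HeytingField.setoid F) size (HeytingField.0# F)) (PRF<-size v v)))
  where
  open RationalFunctions F size
  open RationalFunctionProperties F size

open import Data.Nat using (_+_; _*_; _<_)

theorem2p4 : ∀ {a ℓ₁ ℓ₂} (q : ℕ) → PrimePower q →
    (F : HeytingField a ℓ₁ ℓ₂) (size : HasSize (HeytingField.setoid F) q) →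
    let open RationalFunctions F size in
    ∀ (v : ℕ) → 1 < v → 𝒢 v ≡ (q + 1) * sum (map (N v) (upTo v))
theorem2p4 zero _ F size v 1<v = contradiction (Inverse.to size (HeytingField.0# F)) Fin.¬Fin0
theorem2p4 (suc q) _ F size v 1<v = begin
  N v v + 2 * S      ≡⟨ cong (_+ 2 * S) (N-diagonal F size (ℕ.<-trans (s≤s z≤n) 1<v)) ⟩
  -- Here q is one less than the order of the field, so q + 2 is that order plus one.
  q * S + 2 * S      ≡⟨ ℕ.*-distribʳ-+ S q 2 ⟨
  (q + 2) * S        ≡⟨ cong (_* S) (ℕ.+-suc q 1) ⟩
  (suc q + 1) * S    ∎
  where
  open RationalFunctions F size
  open ≡ using (cong)
  open ≡.≡-Reasoning
  S = sum (map (N v) (upTo v))
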